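{- Let $m,n\ge 1$ be integers. The number of spherical $K_{m+1,n}$-parking functions is \[ |\mathrm{sPF}(K_{m+1,n})|=\sum_{i=1}^{m+n}(-1)^{m+n-i}\sum_{(\mathbf{s},\mathbf{t})\in\Gamma_i}\binom{m}{s_1,\,s_2-s_1,\,\dots,\,s_i-s_{i-1}}\binom{n}{t_1,\,t_2-t_1,\,\dots,\,t_i-t_{i-1}}\,\mu(\mathbf{s},\mathbf{t}). \]
   Context: $\mathbb{N}=\{0,1,2,\dots\}$, $[N]=\{1,\dots,N\}$. $K_{m+1,n}$ is the complete bipartite graph on $\{0,1,\dots,m\}\sqcup\{m+1,\dots,m+n\}$ with root $0$ (in the part of size $m+1$). Spherical parking functions: let $G$ be an undirected loopless graph on $V=\{0,1,\dots,N\}$, $N\ge2$, with root $0$ and $a_{ij}$ edges between $i$ and $j$ (here $N=m+n$). Let $R=\mathbb{K}[x_1,\dots,x_N]$ over a field $\mathbb{K}$. For $\emptyset\ne A\subseteq[N]$ put $d_A(i)=\sum_{j\in V\setminus A}a_{ij}$ and $m_A=\prod_{i\in A}x_i^{d_A(i)}$. Let $\mathcal{M}_G=\langle m_A:\emptyset\neq A\subseteq[N]\rangle$ and $\mathcal{M}_G^{(k)}=\langle m_A:\emptyset\ne A\subseteq[N],\ |A|\le k+1\rangle$. Then $\mathrm{sPF}(G)=\{\mathcal{P}\in\mathbb{N}^N:\ \mathbf{x}^{\mathcal{P}}\in\mathcal{M}_G\setminus\mathcal{M}_G^{(N-2)}\}$. For $1\le i\le m+n$, $\Gamma_i$ is the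 set of ordered pairs $(\mathbf{s},\mathbf{t})$ of $i$-tuples of nonnegative integers $\mathbf{s}=(s_1,\dots,s_i)$, $\mathbf{t}=(t_1,\dots,t_i)$ such that $0=s_0\le s_1\le\cdots\le s_i$, $0=t_0\le t_1\le\cdots\le t_i$, $s_i+t_i=m+n$, and $s_{j-1}+t_{j-1}<s_j+t_j$ for $1\le j\le i$. A multinomial coefficient $\binom{p}{c_1,\dots,c_i}$ equals $p!/(c_1!\cdots c_i!)$ if $c_1+\cdots+c_i=p$ and $0$ otherwise (so only pairs with $s_i=m$, $t_i=n$ contribute). For $(\mathbf{s},\mathbf{t})\in\Gamma_i$ let $\mathfrak{T}(\mathbf{s},\mathbf{t})=\{j\in[i]: s_j<m\text{ and }t_j<n\}$ and \[ \mu(\mathbf{s},\mathbf{t})=\prod_{j\in\mathfrak{T}(\mathbf{s},\mathbf{t})}(n-t_j)^{s_j-s_{j-1}}(m-s_j)^{t_j-t_{j-1}}, \] with the empty product equal to $1$. -}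

module Defs where

open import Algebra.Apartness.Bundles using (HeytingField)
open import Data.Bool using (Bool; if_then_else_; _xor_)
open import Data.Bool.Properties using (xor-comm; xor-same)
open import Data.Fin as Fin using (Fin; toℕ; inject₁; fromℕ)
open import Data.Fin.Properties using (all?)
open import Data.Fin.Subset using (Subset; outside; Nonempty; ∁; ∣_∣)
import Data.Fin.Subset.Properties as Subsetₚ
open import Data.Integer as ℤ using (ℤ; 0ℤ; -1ℤ)
open import Data.List as List using (List; []; _∷_; _++_; upTo; allFin; filter; cartesianProduct; cartesianProductWith)
open import Data.List.Membership.Propositional using (_∈_)
open import Data.List.Membership.Propositional.Properties
open import Data.List.Relation.Unary.All.Properties using (map⁺)
import Data.List.Relation.Unary.All as All
import Data.List.Relation.Unary.AllPairs as AllPairs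
open import Data.List.Relation.Unary.Any using (here)
open import Data.List.Relation.Unary.Unique.Propositional using (Unique)
import Data.List.Relation.Unary.Unique.Propositional.Properties as Uniqueₚ
open import Data.Nat using (ℕ; zero; suc; _+_; _*_; _∸_; _^_; _/_; _!; _≤_; _<_; _≤ᵇ_; _≟_; _≤?_; _<?_; NonZero; s≤s)
open import Data.Nat.ListAction using (sum; product)
open import Data.Nat.ListAction.Properties using (product≢0)
open import Data.Nat.Properties using (_!≢0; ≤-refl; ≤-reflexive; ≤-trans; m≤m+n; m≤n+m)
open import Data.Product using (∃; ∃-syntax; _×_; _,_; proj₁; proj₂; uncurry)
open import Data.Vec using (Vec; []; _∷_; lookup; tabulate; zipWith)
open import Data.Vec.Properties using (≡-dec; ∷-injective)
open import Function using (_∘_)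
open import Function.Bundles using (Bijection; _⇔_; mk⇔)
open import Level using (_⊔_)
open import Relation.Binary.PropositionalEquality using (_≡_; refl; cong; setoid)
import Relation.Binary.Construct.On as On
open import Relation.Nullary using (Dec; ¬_; does)
open import Relation.Nullary.Decidable using (map′; _×-dec_)
open import Relation.Unary using (Pred)

-- A subset of A, given as a predicate, has c elements.  Two elements of the
-- subset are equal when they are equal in A, whatever the membership proofs.
HasCardinality : ∀ {a p} {A : Set a} → Pred A p → ℕ → Set (a ⊔ p)
HasCardinality {A = A} P c =
  Bijection (setoid (Fin c)) (On.setoid {B = ∃ P} (setoid A) proj₁)

-- The polynomial ring K[x₁,…,x_N].  A polynomial is a finite formal sum of
-- terms (coefficient , exponent vector); repeated exponents and zero
-- coefficients are allowed, and equality is equality of all coefficients.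
-- A Heyting field is in particular nontrivial: 0# # 0# is excluded by
-- irreflexivity, so 0# is not invertible.
module Polynomial {c ℓ₁ ℓ₂} (K : HeytingField c ℓ₁ ℓ₂) (N : ℕ) where

  private module K = HeytingField K

  Exponent : Set
  Exponent = Vec ℕ N

  Poly : Set c
  Poly = List (K.Carrier × Exponent)

  coeff : Poly → Exponent → K.Carrier
  coeff p e = List.foldr K._+_ K.0# (List.map proj₁ (filter (λ t → ≡-dec _≟_ (proj₂ t) e) p))

  infix 4 _≈ₚ_
  _≈ₚ_ : Poly → Poly → Set ℓ₁
  p ≈ₚ q = ∀ e → coeff p e K.≈ coeff q e

  _+ₚ_ : Poly → Poly → Poly
  _+ₚ_ = _++_

  _*ₚ_ : Poly → Poly → Poly
  _*ₚ_ = cartesianProductWith λ (a , d) (b , e) → a K.* b , zipWith _+_ d e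

  monomial : Exponent → Poly
  monomial e = (K.1# , e) ∷ []

  combination : ∀ {s} (S : Pred Poly s) → List (Poly × ∃ S) → Poly
  combination S []                = []
  combination S ((q , g , _) ∷ L) = (q *ₚ g) +ₚ combination S L

  -- The ideal generated by S: all finite sums Σ q g with q ∈ K[x] and g ∈ S.
  ⟨_⟩ : ∀ {s} → Pred Poly s → Pred Poly (c ⊔ ℓ₁ ⊔ s)
  ⟨ S ⟩ f = ∃[ L ] (f ≈ₚ combination S L)

-- An undirected loopless multigraph on {0,…,N}, with root 0.
record RootedGraph (N : ℕ) : Set where
  field
    edges     : Fin (suc N) → Fin (suc N) → ℕ
    symmetric : ∀ i j → edges i j ≡ edges j i
    loopless  : ∀ i → edges i i ≡ 0

-- K_{m+1,n}, with parts {0,…,m} and {m+1,…,m+n}.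
completeBipartite : (m n : ℕ) → RootedGraph (m + n)
completeBipartite m n = record
  { edges     = λ i j → count (first i xor first j)
  ; symmetric = λ i j → cong count (xor-comm (first i) (first j))
  ; loopless  = λ i → cong count (xor-same (first i))
  }
  where
  first : Fin (suc (m + n)) → Bool
  first i = toℕ i ≤ᵇ m

  count : Bool → ℕ
  count b = if b then 1 else 0

-- Subsets A of [N] are Subset N; the element i : Fin N stands for the vertex
-- Fin.suc i of the graph (and for the variable x_{i+1}), so that A, viewed in
-- V = {0,…,N}, is outside ∷ A.
module ParkingFunctions {c ℓ₁ ℓ₂} (K : HeytingField c ℓ₁ ℓ₂) {N : ℕ} (G : RootedGraph N) where

  open RootedGraph G
  open Polynomial K N

  degree : Subset N → Fin N → ℕ
  degree A i = sum (List.map (edges (Fin.suc i)) (filter (Subsetₚ._∈? ∁ (outside ∷ A)) (allFin (suc N))))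

  generator : Subset N → Poly
  generator A = monomial (tabulate λ i → if lookup A i then degree A i else 0)

  idealM : Pred Poly (c ⊔ ℓ₁)
  idealM = ⟨ (λ g → ∃[ A ] (Nonempty A × g ≡ generator A)) ⟩

  skeletonIdealM : ℕ → Pred Poly (c ⊔ ℓ₁)
  skeletonIdealM k = ⟨ (λ g → ∃[ A ] (Nonempty A × ∣ A ∣ ≤ suc k × g ≡ generator A)) ⟩

  -- Meant for N ≥ 2, where N ∸ 2 is the true difference.
  sPF : Pred (Vec ℕ N) (c ⊔ ℓ₁)
  sPF P = idealM (monomial P) × ¬ skeletonIdealM (N ∸ 2) (monomial P)

open ParkingFunctions public using (sPF)

-- For s = (s₁,…,s_i) and s₀ = 0, an index j : Fin i stands for j+1 ∈ [i]:
-- current s j is s_{j+1} and previous s j is s_j.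
module _ {i : ℕ} where

  current previous increment : Vec ℕ i → Fin i → ℕ
  current   s j = lookup (0 ∷ s) (Fin.suc j)
  previous  s j = lookup (0 ∷ s) (inject₁ j)
  increment s j = current s j ∸ previous s j

  final : Vec ℕ i → ℕ
  final s = lookup (0 ∷ s) (fromℕ i)

  increments : Vec ℕ i → List ℕ
  increments s = List.map (increment s) (allFin i)

multinomial : ℕ → List ℕ → ℕ
multinomial p cs = if does (sum cs ≟ p) then p ! / product (List.map _! cs) else 0
  where instance
  _ : NonZero (product (List.map _! cs))
  _ = product≢0 (map⁺ (All.universal (λ k → k !≢0) cs))

module _ (m n : ℕ) where

  record Γ (i : ℕ) (s t : Vec ℕ i) : Set where
    constructor mkΓ
    field
      s-monotone : ∀ j → previous s j ≤ current s j
      t-monotone : ∀ j → previous t j ≤ current t j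
      total      : final s + final t ≡ m + n
      increasing : ∀ j → previous s j + previous t j < current s j + current t j

  Γ? : ∀ {i} (s t : Vec ℕ i) → Dec (Γ i s t)
  Γ? s t = map′
    (λ (a , b , c , d) → mkΓ a b c d)
    (λ (mkΓ a b c d) → a , b , c , d)
    (all? (λ j → previous s j ≤? current s j)
      ×-dec all? (λ j → previous t j ≤? current t j)
      ×-dec (final s + final t ≟ m + n)
      ×-dec all? (λ j → previous s j + previous t j <? current s j + current t j))

  module _ {i : ℕ} (s t : Vec ℕ i) where

    𝔗 : Pred (Fin i) _
    𝔗 j = current s j < m × current t j < n

    𝔗? : ∀ j → Dec (𝔗 j)
    𝔗? j = (current s j <? m) ×-dec (current t j <? n)

    factor : Fin i → ℕ
    factor j = (n ∸ current t j) ^ increment s j * (m ∸ current s j) ^ increment t j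

    μ : ℕ
    μ = product (List.map factor (filter 𝔗? (allFin i)))

tuples : ℕ → (i : ℕ) → List (Vec ℕ i)
tuples b zero    = [] ∷ []
tuples b (suc i) = cartesianProductWith _∷_ (upTo (suc b)) (tuples b i)

-- All entries of a pair in Γ_i are at most m + n, so this lists all of Γ_i;
-- see ∈-Γ-list and Γ-list-unique below.
Γ-list : (m n i : ℕ) → List (Vec ℕ i × Vec ℕ i)
Γ-list m n i = filter (uncurry (Γ? m n)) (cartesianProduct (tuples (m + n) i) (tuples (m + n) i))

sumℤ : List ℤ → ℤ
sumℤ = List.foldr ℤ._+_ 0ℤ

module _ (m n : ℕ) where

  weight : ∀ {i} → Vec ℕ i × Vec ℕ i → ℕ
  weight (s , t) = multinomial m (increments s) * multinomial n (increments t) * μ m n s t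

  summand : ℕ → ℤ
  summand i = -1ℤ ℤ.^ (m + n ∸ i) ℤ.* ℤ.+ sum (List.map weight (Γ-list m n i))

  signedSum : ℤ
  signedSum = sumℤ (List.map summand (List.map suc (upTo (m + n))))

private
  ∈-tuples : ∀ {b i} (v : Vec ℕ i) → (∀ j → lookup v j ≤ b) → v ∈ tuples b i
  ∈-tuples []      _ = here refl
  ∈-tuples (x ∷ v) h =
    ∈-cartesianProductWith⁺ _∷_ (∈-upTo⁺ (s≤s (h Fin.zero))) (∈-tuples v (h ∘ Fin.suc))

  tuples-unique : ∀ b i → Unique (tuples b i)
  tuples-unique b zero    = All.[] AllPairs.∷ AllPairs.[]
  tuples-unique b (suc i) =
    Uniqueₚ.cartesianProductWith⁺ _∷_ ∷-injective (Uniqueₚ.upTo⁺ (suc b)) (tuples-unique b i)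

  ≤-last : ∀ {i} (v : Vec ℕ (suc i)) →
           (∀ j → lookup v (inject₁ j) ≤ lookup v (Fin.suc j)) →
           ∀ k → lookup v k ≤ lookup v (fromℕ i)
  ≤-last {zero}  v       h Fin.zero    = ≤-refl
  ≤-last {suc i} (x ∷ v) h Fin.zero    = ≤-trans (h Fin.zero) (≤-last v (h ∘ Fin.suc) Fin.zero)
  ≤-last {suc i} (x ∷ v) h (Fin.suc k) = ≤-last v (h ∘ Fin.suc) k

∈-Γ-list : ∀ {m n i st} → st ∈ Γ-list m n i ⇔ uncurry (Γ m n i) st
∈-Γ-list {m} {n} {i} {s , t} = mk⇔
  (λ st∈ → proj₂ (∈-filter⁻ (uncurry (Γ? m n)) {xs = cartesianProduct (tuples (m + n) i) (tuples (m + n) i)} st∈))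
  (λ γ → let open Γ γ in ∈-filter⁺ (uncurry (Γ? m n))
    (∈-cartesianProduct⁺
      (∈-tuples s λ j → ≤-trans (≤-last (0 ∷ s) s-monotone (Fin.suc j))
                          (≤-trans (m≤m+n _ (final t)) (≤-reflexive total)))
      (∈-tuples t λ j → ≤-trans (≤-last (0 ∷ t) t-monotone (Fin.suc j))
                          (≤-trans (m≤n+m _ (final s)) (≤-reflexive total))))
    γ)

Γ-list-unique : ∀ m n i → Unique (Γ-list m n i)
Γ-list-unique m n i =
  Uniqueₚ.filter⁺ (uncurry (Γ? m n)) (Uniqueₚ.cartesianProduct⁺ (tuples-unique (m + n) i) (tuples-unique (m + n) i))

{-# OPTIONS --safe #-}
module Submission where

-- Subtracting from each entry the number of edges to the root turns a spherical parking function into a vector P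
-- such that for no nonempty proper A is P i ≥ d A i for all i ∈ A, where d A i is the number of non-root neighbours of i
-- outside A.  Setting d A i = 1 for every A (also the full set) that contains a part of K_{m,n} does not change the ideal, since both
-- versions contain the product of the variables of either part; the new d is still decreasing in A, and it is the
-- one occurring in μ.  For a family d decreasing in A, let g C be the number of such vectors supported on C.
-- Inclusion-exclusion over the set of l ∈ C with P l < d C l gives
--   Σ_{B ⊆ C} g B ∏_{l ∈ C ∖ B} (- d C l) = [C = ∅],
-- so g of the full set is a signed sum over chains of subsets; grouping the chains by the sizes of their
-- intersections with the two parts gives the pairs (s , t) and the multinomial coefficients.

open import Defs
open import Algebra.Apartness.Bundles using (HeytingField)
open import Data.Bool using (Bool; true; false; if_then_else_; _xor_)
import Data.Bool.Properties as Bool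
open import Data.Empty using (⊥-elim)
open import Data.Fin using (Fin; zero; suc; _↑ˡ_; _↑ʳ_; splitAt; toℕ; inject₁; fromℕ)
open import Data.Fin.Properties using (all?; any?; splitAt-↑ˡ; splitAt-↑ʳ; toℕ-↑ˡ; toℕ-↑ʳ; toℕ<n)
open import Data.Fin.Subset using (Subset; inside; outside; _∈_; _∉_; _⊆_; Nonempty; ⊤; ⊥; ⁅_⁆; ∁; ∣_∣)
open import Data.Fin.Subset.Properties
  using (_∈?_; _⊆?_; nonempty?; anySubset?; ⊆-trans; Empty-unique; ∉⊥; ∈⊤; x∈⁅x⁆; x∈⁅y⁆⇒x≡y; ∣p∣≤n; p⊆q⇒∣p∣≤∣q∣; ∣⊤∣≡n; ∣⊥∣≡0; ∣p∣≡n⇒p≡⊤; ∣∁p∣≡n∸∣p∣)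
open import Data.Integer using (ℤ; +_; -_; _+_; _*_; _^_; 0ℤ; 1ℤ; -1ℤ)
import Data.Integer.Properties as ℤ
open import Data.Integer.Tactic.RingSolver using (solve-∀)
open import Data.List as List using (List; []; _∷_; map; filter; length; upTo; applyUpTo; allFin; cartesianProduct; cartesianProductWith)
open import Data.List.Membership.Propositional using (lose) renaming (_∈_ to _∈ₗ_; find to findₗ)
open import Data.List.Membership.Propositional.Properties
  using (∈-cartesianProductWith⁺; ∈-cartesianProductWith⁻; ∈-upTo⁺; ∈-upTo⁻; ∈-++⁻; ∈-lookup; ∈-map⁺; ∈-map⁻; ∈-filter⁺; ∈-filter⁻)
open import Data.List.Properties using (map-upTo; map-tabulate; filter-none; length-map)
import Data.List.Relation.Unary.All as All
open import Data.List.Relation.Unary.All.Properties using (¬Any⇒All¬)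
import Data.List.Relation.Unary.AllPairs as AllPairs
open import Data.List.Relation.Unary.Any as Any using (Any; here; there)
open import Data.List.Relation.Unary.Any.Properties using (lookup-index)
open import Data.List.Relation.Unary.Unique.Propositional using (Unique)
import Data.List.Relation.Unary.Unique.Propositional.Properties as Uniqueₚ
open import Data.Nat as ℕ using (ℕ; zero; suc; _≤_; _<_; _≥_; _<?_; _≤?_; _≤ᵇ_; _≟_; _∸_; _!; NonZero; z≤n; s≤s)
open import Data.Nat.Combinatorics
  using (_C_; nCn≡1; nCk≡nC[n∸k]; k>n⇒nCk≡0; nCk+nC[k+1]≡[n+1]C[k+1]; k![n∸k]!∣n!; nCk≡n!/k![n-k]!)
open import Data.Nat.Divisibility using ()
  renaming (_∣_ to _divides_; ∣-refl to div-refl; ∣-trans to div-trans; *-monoʳ-∣ to div-monoʳ)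
open import Data.Nat.DivMod using (m/n*n≡m)
open import Data.Nat.ListAction using (sum; product)
import Data.Nat.Properties as ℕ
open import Data.Nat.Tactic.RingSolver using () renaming (solve-∀ to solveℕ-∀)
open import Data.Product using (∃; ∃₂; ∃-syntax; _×_; _,_; proj₁; proj₂; uncurry)
open import Data.Sum using (inj₁; inj₂; [_,_]′)
open import Data.Vec using (Vec; []; _∷_; _++_; lookup; here; there; zipWith; tabulate; replicate; take; drop)
open import Data.Vec.Properties
  using (≡-dec; ∷-injective; take-map; drop-map; lookup-zipWith; lookup∘tabulate; lookup-++ˡ; lookup-++ʳ; lookup-replicate; lookup⇒[]=; []=⇒lookup)
open import Function using (_∘_; const; id)
open import Relation.Binary.Definitions using (tri<; tri≈; tri>)
open import Relation.Binary.PropositionalEquality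
open import Relation.Nullary using (Dec; yes; no; does; ¬_)
open import Relation.Nullary.Decidable using (_×-dec_; ¬?; _→-dec_; dec-true; dec-false)
open import Relation.Unary using (Pred; Decidable)

-- Finite sums

-- Two obstacles shape the argument. On the full set the original d is 0 everywhere, so keeping that
-- value would make every vector unstable; raising it to 1 there alone would break monotonicity,
-- because a set containing one part can already have the value 0 on the other part. The value 1 on
-- all sets containing a part avoids both, and it accounts for the missing factors of μ at indices
-- outside `𝔗`.
--
-- The recursion for g is never unrolled, and no chain of subsets is ever formed. The recursion says
-- that g, as a row vector, times a unitriangular matrix is a unit vector. The value of g at the
-- full set then equals the value at the empty set of the column vector that the same matrix sends
-- to the other unit vector. That column may be sought among functions of the two sizes alone, where
-- it is the finite Neumann series of the inverse matrix, that is, a signed sum over walks on pairs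
-- of sizes. In it each step and each added element contributes one factor -1, which gives the
-- exponent i + (m + n), of the same parity as m + n - i.

private variable
  A B D : Set

opaque
  ∑ : List A → (A → ℤ) → ℤ
  ∑ xs f = sumℤ (map f xs)

  𝟙 : ∀ {p} {P : Set p} → Dec P → ℤ
  𝟙 P? = if does P? then 1ℤ else 0ℤ

  𝟙-true : ∀ {p} {P : Set p} (P? : Dec P) → P → 𝟙 P? ≡ 1ℤ
  𝟙-true (yes _) _ = refl
  𝟙-true (no ¬p) p = ⊥-elim (¬p p)

  𝟙-false : ∀ {p} {P : Set p} (P? : Dec P) → ¬ P → 𝟙 P? ≡ 0ℤ
  𝟙-false (yes p) ¬p = ⊥-elim (¬p p)
  𝟙-false (no _)  _  = refl

  𝟙-cong : ∀ {p q} {P : Set p} {Q : Set q} (P? : Dec P) (Q? : Dec Q) → (P → Q) → (Q → P) → 𝟙 P? ≡ 𝟙 Q?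
  𝟙-cong (yes p) Q? f g = sym (𝟙-true Q? (f p))
  𝟙-cong (no ¬p) Q? f g = sym (𝟙-false Q? (¬p ∘ g))

  𝟙-× : ∀ {p q} {P : Set p} {Q : Set q} (P? : Dec P) (Q? : Dec Q) → 𝟙 (P? ×-dec Q?) ≡ 𝟙 P? * 𝟙 Q?
  𝟙-× (yes _) Q? = sym (ℤ.*-identityˡ (𝟙 Q?))
  𝟙-× (no _)  Q? = refl

  ∑-cong : (xs : List A) {f g : A → ℤ} → (∀ x → f x ≡ g x) → ∑ xs f ≡ ∑ xs g
  ∑-cong []       eq = refl
  ∑-cong (x ∷ xs) eq = cong₂ _+_ (eq x) (∑-cong xs eq)

  ∑-cong-∈ : (xs : List A) {f g : A → ℤ} → (∀ {x} → x ∈ₗ xs → f x ≡ g x) → ∑ xs f ≡ ∑ xs g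
  ∑-cong-∈ []       eq = refl
  ∑-cong-∈ (x ∷ xs) eq = cong₂ _+_ (eq (here refl)) (∑-cong-∈ xs (eq ∘ there))

  ∑-zero : (xs : List A) {f : A → ℤ} → (∀ x → f x ≡ 0ℤ) → ∑ xs f ≡ 0ℤ
  ∑-zero []       eq = refl
  ∑-zero (x ∷ xs) eq rewrite eq x = trans (ℤ.+-identityˡ _) (∑-zero xs eq)

  ∑-++ : (xs ys : List A) (f : A → ℤ) → ∑ (xs List.++ ys) f ≡ ∑ xs f + ∑ ys f
  ∑-++ []       ys f = sym (ℤ.+-identityˡ _)
  ∑-++ (x ∷ xs) ys f = trans (cong (_+_ (f x)) (∑-++ xs ys f)) (sym (ℤ.+-assoc (f x) _ _))

  ∑-sumℤ : (xs : List A) (f : A → ℤ) → sumℤ (map f xs) ≡ ∑ xs f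
  ∑-sumℤ xs f = refl

  ∑-pos : (xs : List A) (f : A → ℕ) → + sum (map f xs) ≡ ∑ xs (λ x → + f x)
  ∑-pos []       f = refl
  ∑-pos (x ∷ xs) f = trans (ℤ.pos-+ (f x) _) (cong (_+_ (+ f x)) (∑-pos xs f))

  ∑-map : (h : A → B) (xs : List A) (f : B → ℤ) → ∑ (map h xs) f ≡ ∑ xs (f ∘ h)
  ∑-map h []       f = refl
  ∑-map h (x ∷ xs) f = cong (_+_ (f (h x))) (∑-map h xs f)

  ∑-[] : (f : A → ℤ) → ∑ [] f ≡ 0ℤ
  ∑-[] f = refl

  ∑-∷ : (x : A) (xs : List A) (f : A → ℤ) → ∑ (x ∷ xs) f ≡ f x + ∑ xs f
  ∑-∷ x xs f = refl

  ∑-[-] : (x : A) (f : A → ℤ) → ∑ (x ∷ []) f ≡ f x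
  ∑-[-] x f = ℤ.+-identityʳ (f x)

  ∑-+ : (xs : List A) (f g : A → ℤ) → ∑ xs (λ x → f x + g x) ≡ ∑ xs f + ∑ xs g
  ∑-+ []       f g = refl
  ∑-+ (x ∷ xs) f g = trans (cong (_+_ (f x + g x)) (∑-+ xs f g)) (interchange (f x) (g x) _ _)
    where
    interchange : ∀ a b c d → a + b + (c + d) ≡ a + c + (b + d)
    interchange = solve-∀

  ∑-*ˡ : (xs : List A) (k : ℤ) (f : A → ℤ) → ∑ xs (λ x → k * f x) ≡ k * ∑ xs f
  ∑-*ˡ []       k f = sym (ℤ.*-zeroʳ k)
  ∑-*ˡ (x ∷ xs) k f = trans (cong (_+_ (k * f x)) (∑-*ˡ xs k f)) (sym (ℤ.*-distribˡ-+ k _ _))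

  ∑-*ʳ : (xs : List A) (k : ℤ) (f : A → ℤ) → ∑ xs (λ x → f x * k) ≡ ∑ xs f * k
  ∑-*ʳ xs k f = trans (∑-cong xs λ x → ℤ.*-comm (f x) k) (trans (∑-*ˡ xs k f) (ℤ.*-comm k _))

  ∑-swap : (xs : List A) (ys : List B) (f : A → B → ℤ) →
           ∑ xs (λ x → ∑ ys (f x)) ≡ ∑ ys (λ y → ∑ xs (λ x → f x y))
  ∑-swap []       ys f = sym (∑-zero ys λ _ → refl)
  ∑-swap (x ∷ xs) ys f = trans (cong (_+_ (∑ ys (f x))) (∑-swap xs ys f)) (sym (∑-+ ys (f x) _))

  ∑-cartesianProductWith : (h : A → B → D) (xs : List A) (ys : List B) (f : D → ℤ) →
    ∑ (cartesianProductWith h xs ys) f ≡ ∑ xs (λ x → ∑ ys (λ y → f (h x y)))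
  ∑-cartesianProductWith h []       ys f = refl
  ∑-cartesianProductWith h (x ∷ xs) ys f =
    trans (∑-++ (map (h x) ys) _ f) (cong₂ _+_ (∑-map (h x) ys f) (∑-cartesianProductWith h xs ys f))

  ∑-filter : ∀ {p} {P : Pred A p} (P? : Decidable P) (xs : List A) (f : A → ℤ) →
             ∑ (filter P? xs) f ≡ ∑ xs (λ x → 𝟙 (P? x) * f x)
  ∑-filter P? []       f = refl
  ∑-filter P? (x ∷ xs) f with P? x
  ... | yes _ = cong₂ _+_ (sym (ℤ.*-identityˡ (f x))) (∑-filter P? xs f)
  ... | no _  = trans (∑-filter P? xs f) (sym (ℤ.+-identityˡ _))

  ∑-length : (xs : List A) → ∑ xs (λ _ → 1ℤ) ≡ + length xs
  ∑-length []       = refl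
  ∑-length (x ∷ xs) = cong (_+_ 1ℤ) (∑-length xs)

  ∑-δ : (_≟_ : (x y : A) → Dec (x ≡ y)) {xs : List A} {y : A} → Unique xs → y ∈ₗ xs → (f : A → ℤ) →
        ∑ xs (λ x → 𝟙 (x ≟ y) * f x) ≡ f y
  ∑-δ _≟_ {x ∷ xs} (x∉ AllPairs.∷ _) (here refl) f =
    trans (cong₂ _+_ (cong (_* f x) (𝟙-true (x ≟ x) refl)) (tail xs x∉))
          (trans (ℤ.+-identityʳ _) (ℤ.*-identityˡ (f x)))
    where
    tail : ∀ ys → All.All (x ≢_) ys → ∑ ys (λ z → 𝟙 (z ≟ x) * f z) ≡ 0ℤ
    tail []       All.[]        = refl
    tail (z ∷ zs) (p All.∷ ps) rewrite 𝟙-false (z ≟ x) (p ∘ sym) = trans (ℤ.+-identityˡ _) (tail zs ps)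
  ∑-δ _≟_ {x ∷ xs} {y} (x∉ AllPairs.∷ u) (there y∈) f =
    trans (cong₂ _+_ (cong (_* f x) (𝟙-false (x ≟ y) (All.lookup x∉ y∈))) (∑-δ _≟_ u y∈ f))
          (ℤ.+-identityˡ _)

  ∑-upTo-< : ∀ {e b} → e ≤ b → ∑ (upTo b) (λ p → 𝟙 (p <? e)) ≡ + e
  ∑-upTo-< {e}     {zero}  z≤n     = refl
  ∑-upTo-< {zero}  {suc b} z≤n     = ∑-zero (upTo (suc b)) λ p → 𝟙-false (p <? 0) λ ()
  ∑-upTo-< {suc e} {suc b} (s≤s h) = cong (_+_ 1ℤ) (begin
    ∑ (applyUpTo suc b) (λ p → 𝟙 (p <? suc e)) ≡⟨ cong (λ xs → ∑ xs (λ p → 𝟙 (p <? suc e))) (map-upTo suc b) ⟨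
    ∑ (map suc (upTo b)) (λ p → 𝟙 (p <? suc e))          ≡⟨ ∑-map suc (upTo b) _ ⟩
    ∑ (upTo b) (λ p → 𝟙 (suc p <? suc e))                 ≡⟨ ∑-cong (upTo b) (λ p → 𝟙-cong (suc p <? suc e) (p <? e) ℕ.s≤s⁻¹ s≤s) ⟩
    ∑ (upTo b) (λ p → 𝟙 (p <? e))                         ≡⟨ ∑-upTo-< h ⟩
    + e ∎)
    where open ≡-Reasoning

-- Enumeration of subsets

subsets : ∀ N → List (Subset N)
subsets zero    = [] ∷ []
subsets (suc N) = cartesianProductWith _∷_ (outside ∷ inside ∷ []) (subsets N)

∈-subsets : ∀ {N} (S : Subset N) → S ∈ₗ subsets N
∈-subsets []            = here refl
∈-subsets (outside ∷ S) = ∈-cartesianProductWith⁺ _∷_ {outside ∷ inside ∷ []} (here refl) (∈-subsets S)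
∈-subsets (inside ∷ S)  = ∈-cartesianProductWith⁺ _∷_ {outside ∷ inside ∷ []} (there (here refl)) (∈-subsets S)

subsets-unique : ∀ N → Unique (subsets N)
subsets-unique zero    = All.[] AllPairs.∷ AllPairs.[]
subsets-unique (suc N) = Uniqueₚ.cartesianProductWith⁺ _∷_ ∷-injective
  (((λ ()) All.∷ All.[]) AllPairs.∷ (All.[] AllPairs.∷ AllPairs.[])) (subsets-unique N)

_≟ˢ_ : ∀ {N} (S T : Subset N) → Dec (S ≡ T)
_≟ˢ_ = ≡-dec Bool._≟_

∑-subsets-suc : ∀ {N} (f : Subset (suc N) → ℤ) →
  ∑ (subsets (suc N)) f ≡ ∑ (subsets N) (f ∘ (outside ∷_)) + ∑ (subsets N) (f ∘ (inside ∷_))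
∑-subsets-suc {N} f = trans (∑-++ (map (outside ∷_) (subsets N)) _ f) (cong₂ _+_ (∑-map (outside ∷_) (subsets N) f)
  (trans (∑-++ (map (inside ∷_) (subsets N)) [] f) (trans (cong₂ _+_ (∑-map (inside ∷_) (subsets N) f) (∑-[] f)) (ℤ.+-identityʳ _))))

∑-δ-subsets : ∀ {N} (S : Subset N) (f : Subset N → ℤ) → ∑ (subsets N) (λ T → 𝟙 (T ≟ˢ S) * f T) ≡ f S
∑-δ-subsets S = ∑-δ _≟ˢ_ (subsets-unique _) (∈-subsets S)

-- Stable vectors

-- A 2 by 2 upper unitriangular matrix with x off the diagonal. `links` is the Kronecker product of
-- such matrices, so sums over all subsets factor coordinate by coordinate.
link : Bool → Bool → ℤ → ℤ
link inside  inside  x = 1ℤ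
link inside  outside x = 0ℤ
link outside inside  x = x
link outside outside x = 1ℤ

-- Zero unless S ⊆ S′, and then the product of x over S′ ∖ S.
links : ∀ {N} → Subset N → Subset N → (Fin N → ℤ) → ℤ
links []      []        x = 1ℤ
links (c ∷ S) (c′ ∷ S′) x = link c c′ (x zero) * links S S′ (x ∘ suc)

links-cong : ∀ {N} (S S′ : Subset N) {x y : Fin N → ℤ} → (∀ i → x i ≡ y i) → links S S′ x ≡ links S S′ y
links-cong []      []        eq = refl
links-cong (c ∷ S) (c′ ∷ S′) eq = cong₂ _*_ (cong (link c c′) (eq zero)) (links-cong S S′ (eq ∘ suc))

∑-links-suc : ∀ {N} c (S′ : Subset N) (x : Fin (suc N) → ℤ) →
  ∑ (subsets (suc N)) (λ S → links S (c ∷ S′) x) ≡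
  (link outside c (x zero) + link inside c (x zero)) * ∑ (subsets N) (λ S → links S S′ (x ∘ suc))
∑-links-suc {N} c S′ x = trans (∑-subsets-suc λ S → links S (c ∷ S′) x) (trans
  (cong₂ _+_ (∑-*ˡ (subsets N) (link outside c (x zero)) _) (∑-*ˡ (subsets N) (link inside c (x zero)) _))
  (sym (ℤ.*-distribʳ-+ _ (link outside c (x zero)) (link inside c (x zero)))))

∑-links-⊥ : ∀ {N} (x : Fin N → ℤ) → ∑ (subsets N) (λ S → links S ⊥ x) ≡ 1ℤ
∑-links-⊥ {zero}  x = ∑-[-] [] (λ S → links S [] x)
∑-links-⊥ {suc N} x = trans (∑-links-suc outside (⊥ {N}) x) (trans (ℤ.*-identityˡ _) (∑-links-⊥ (x ∘ suc)))

-- The sum factors as the product of 1 + x i over i ∈ S′, in which one factor is 0.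
∑-links-zero : ∀ {N} (S′ : Subset N) (x : Fin N → ℤ) {i} → i ∈ S′ → x i ≡ -1ℤ →
               ∑ (subsets N) (λ S → links S S′ x) ≡ 0ℤ
∑-links-zero {suc N} (inside ∷ S′) x here       eq =
  trans (∑-links-suc inside S′ x) (cong (λ y → (y + 1ℤ) * ∑ (subsets N) (λ S → links S S′ (x ∘ suc))) eq)
∑-links-zero {suc N} (c ∷ S′)      x (there i∈) eq =
  trans (∑-links-suc c S′ x)
    (trans (cong (k *_) (∑-links-zero S′ (x ∘ suc) i∈ eq)) (ℤ.*-zeroʳ k))
  where
  k : ℤ
  k = link outside c (x zero) + link inside c (x zero)

Supported : ∀ {N} → Subset N → Subset N → (Fin N → ℤ) → Set
Supported S S′ x = S ⊆ S′ × (∀ {i} → i ∈ S′ → i ∉ S → x i ≢ 0ℤ)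

links-≢0 : ∀ {N} (S S′ : Subset N) (x : Fin N → ℤ) → links S S′ x ≢ 0ℤ → Supported S S′ x
links-≢0 []      []        x ≢0 = (λ ()) , λ ()
links-≢0 (c ∷ S) (c′ ∷ S′) x ≢0 = sub c c′ ≢0 , nz c c′ ≢0
  where
  rec : Supported S S′ (x ∘ suc)
  rec = links-≢0 S S′ (x ∘ suc) λ eq → ≢0 (trans (cong (link c c′ (x zero) *_) eq) (ℤ.*-zeroʳ (link c c′ (x zero))))

  sub : ∀ c c′ → link c c′ (x zero) * links S S′ (x ∘ suc) ≢ 0ℤ → c ∷ S ⊆ c′ ∷ S′
  sub inside inside  _ here       = here
  sub inside outside h here       = ⊥-elim (h refl)
  sub _      _       _ (there i∈) = there (proj₁ rec i∈)

  nz : ∀ c c′ → link c c′ (x zero) * links S S′ (x ∘ suc) ≢ 0ℤ →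
       ∀ {i} → i ∈ c′ ∷ S′ → i ∉ c ∷ S → x i ≢ 0ℤ
  nz inside  inside _ here      i∉ = ⊥-elim (i∉ here)
  nz outside inside h here      i∉ = λ eq → h (cong (_* links S S′ (x ∘ suc)) eq)
  nz _       _      _ (there p) i∉ = proj₂ rec p (i∉ ∘ there)

-- Sums over boxes of vectors

module _ (b : ℕ) where

  box : ∀ {N} → Subset N → List (Vec ℕ N)
  box []            = [] ∷ []
  box (outside ∷ S) = map (0 ∷_) (box S)
  box (inside ∷ S)  = cartesianProductWith _∷_ (upTo b) (box S)

  ∈-box : ∀ {N} (P : Vec ℕ N) → (∀ i → lookup P i < b) → P ∈ₗ box ⊤
  ∈-box []      h = here refl
  ∈-box (p ∷ P) h = ∈-cartesianProductWith⁺ _∷_ (∈-upTo⁺ (h zero)) (∈-box P (h ∘ suc))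

  box-unique : ∀ {N} → Unique (box (⊤ {N}))
  box-unique {zero}  = All.[] AllPairs.∷ AllPairs.[]
  box-unique {suc N} = Uniqueₚ.cartesianProductWith⁺ _∷_ ∷-injective (Uniqueₚ.upTo⁺ b) box-unique

  LocalOn : ∀ {N} → Subset N → (Vec ℕ N → ℤ) → Set
  LocalOn S φ = ∀ P Q → (∀ {i} → i ∈ S → lookup P i ≡ lookup Q i) → φ P ≡ φ Q

  below : ∀ {N} → (Fin N → ℕ) → Vec ℕ N → Fin N → ℤ
  below e P i = - 𝟙 (lookup P i <? e i)

  -- Each coordinate in S′ but not in S can be summed out on its own, since φ ignores it. Exactly e
  -- i of its values lie below e i, and e i ≤ b ensures that the box contains them all.
  ∑-box-links : ∀ {N} (S S′ : Subset N) (e : Fin N → ℕ) → (∀ i → e i ≤ b) → (φ : Vec ℕ N → ℤ) → LocalOn S φ →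
    ∑ (box S′) (λ P → links S S′ (below e P) * φ P) ≡ links S S′ (λ i → - (+ e i)) * ∑ (box S) φ
  ∑-box-links [] [] e e≤b φ loc =
    trans (∑-[-] [] (λ P → links [] [] (below e P) * φ P)) (cong (1ℤ *_) (sym (∑-[-] [] φ)))
  ∑-box-links (inside ∷ S) (inside ∷ S′) e e≤b φ loc = begin
    ∑ (box (inside ∷ S′)) (λ P → links (inside ∷ S) (inside ∷ S′) (below e P) * φ P)
      ≡⟨ ∑-cartesianProductWith _∷_ (upTo b) (box S′) _ ⟩
    ∑ (upTo b) (λ p → ∑ (box S′) (λ P → 1ℤ * links S S′ (below (e ∘ suc) P) * φ (p ∷ P)))
      ≡⟨ ∑-cong (upTo b) (λ p → ∑-cong (box S′) λ P → cong (_* φ (p ∷ P)) (ℤ.*-identityˡ (links S S′ (below (e ∘ suc) P)))) ⟩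
    ∑ (upTo b) (λ p → ∑ (box S′) (λ P → links S S′ (below (e ∘ suc) P) * φ (p ∷ P)))
      ≡⟨ ∑-cong (upTo b) (λ p → ∑-box-links S S′ (e ∘ suc) (e≤b ∘ suc) (φ ∘ (p ∷_))
           λ P Q eq → loc (p ∷ P) (p ∷ Q) λ { here → refl ; (there i∈) → eq i∈ }) ⟩
    ∑ (upTo b) (λ p → L * ∑ (box S) (φ ∘ (p ∷_)))
      ≡⟨ ∑-*ˡ (upTo b) L _ ⟩
    L * ∑ (upTo b) (λ p → ∑ (box S) (φ ∘ (p ∷_)))
      ≡⟨ cong₂ _*_ (sym (ℤ.*-identityˡ L)) (sym (∑-cartesianProductWith _∷_ (upTo b) (box S) φ)) ⟩
    1ℤ * L * ∑ (box (inside ∷ S)) φ ∎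
    where
    open ≡-Reasoning
    L : ℤ
    L = links S S′ (λ i → - (+ e (suc i)))
  ∑-box-links (inside ∷ S) (outside ∷ S′) e e≤b φ loc = ∑-zero (box (outside ∷ S′)) λ { (p ∷ P) → refl }
  ∑-box-links (outside ∷ S) (inside ∷ S′) e e≤b φ loc = begin
    ∑ (box (inside ∷ S′)) (λ P → links (outside ∷ S) (inside ∷ S′) (below e P) * φ P)
      ≡⟨ ∑-cartesianProductWith _∷_ (upTo b) (box S′) _ ⟩
    ∑ (upTo b) (λ p → ∑ (box S′) (λ P → - 𝟙 (p <? e zero) * links S S′ (below (e ∘ suc) P) * φ (p ∷ P)))
      -- The head is outside S, so it may be reset to 0, the value at which `box (outside ∷ S)`
      -- freezes it.
      ≡⟨ ∑-cong (upTo b) (λ p → ∑-cong (box S′) λ P → trans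
           (cong (- 𝟙 (p <? e zero) * links S S′ (below (e ∘ suc) P) *_) (loc (p ∷ P) (0 ∷ P) λ { (there _) → refl }))
           (ℤ.*-assoc (- 𝟙 (p <? e zero)) _ _)) ⟩
    ∑ (upTo b) (λ p → ∑ (box S′) (λ P → - 𝟙 (p <? e zero) * (links S S′ (below (e ∘ suc) P) * φ (0 ∷ P))))
      ≡⟨ ∑-cong (upTo b) (λ p → ∑-*ˡ (box S′) (- 𝟙 (p <? e zero)) _) ⟩
    ∑ (upTo b) (λ p → - 𝟙 (p <? e zero) * R)
      ≡⟨ ∑-*ʳ (upTo b) R _ ⟩
    ∑ (upTo b) (λ p → - 𝟙 (p <? e zero)) * R
      ≡⟨ cong₂ _*_ neg (∑-box-links S S′ (e ∘ suc) (e≤b ∘ suc) (φ ∘ (0 ∷_))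
           λ P Q eq → loc (0 ∷ P) (0 ∷ Q) λ { (there i∈) → eq i∈ }) ⟩
    - (+ e zero) * (L * ∑ (box S) (φ ∘ (0 ∷_)))
      ≡⟨ ℤ.*-assoc (- (+ e zero)) L _ ⟨
    - (+ e zero) * L * ∑ (box S) (φ ∘ (0 ∷_))
      ≡⟨ cong (- (+ e zero) * L *_) (∑-map (0 ∷_) (box S) φ) ⟨
    - (+ e zero) * L * ∑ (box (outside ∷ S)) φ ∎
    where
    open ≡-Reasoning
    L R : ℤ
    L = links S S′ (λ i → - (+ e (suc i)))
    R = ∑ (box S′) (λ P → links S S′ (below (e ∘ suc) P) * φ (0 ∷ P))
    neg : ∑ (upTo b) (λ p → - 𝟙 (p <? e zero)) ≡ - (+ e zero)
    neg = trans (∑-cong (upTo b) (λ p → sym (ℤ.-1*i≡-i _))) (trans (∑-*ˡ (upTo b) -1ℤ _)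
      (trans (cong (-1ℤ *_) (∑-upTo-< (e≤b zero))) (ℤ.-1*i≡-i _)))
  ∑-box-links (outside ∷ S) (outside ∷ S′) e e≤b φ loc = begin
    ∑ (box (outside ∷ S′)) (λ P → links (outside ∷ S) (outside ∷ S′) (below e P) * φ P)
      ≡⟨ ∑-map (0 ∷_) (box S′) _ ⟩
    ∑ (box S′) (λ P → 1ℤ * links S S′ (below (e ∘ suc) P) * φ (0 ∷ P))
      ≡⟨ ∑-cong (box S′) (λ P → cong (_* φ (0 ∷ P)) (ℤ.*-identityˡ (links S S′ (below (e ∘ suc) P)))) ⟩
    ∑ (box S′) (λ P → links S S′ (below (e ∘ suc) P) * φ (0 ∷ P))
      ≡⟨ ∑-box-links S S′ (e ∘ suc) (e≤b ∘ suc) (φ ∘ (0 ∷_))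
           (λ P Q eq → loc (0 ∷ P) (0 ∷ Q) λ { (there i∈) → eq i∈ }) ⟩
    L * ∑ (box S) (φ ∘ (0 ∷_))
      ≡⟨ cong₂ _*_ (sym (ℤ.*-identityˡ L)) (sym (∑-map (0 ∷_) (box S) φ)) ⟩
    1ℤ * L * ∑ (box (outside ∷ S)) φ ∎
    where
    open ≡-Reasoning
    L : ℤ
    L = links S S′ (λ i → - (+ e (suc i)))

module Stability {N : ℕ} (d : Subset N → Fin N → ℕ) where

  Unstable : Subset N → Vec ℕ N → Subset N → Set
  Unstable S P B = Nonempty B × B ⊆ S × (∀ i → i ∈ B → d B i ≤ lookup P i)

  Stable : Subset N → Vec ℕ N → Set
  Stable S P = ¬ ∃ (Unstable S P)

  stable? : ∀ S P → Dec (Stable S P)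
  stable? S P = ¬? (anySubset? λ B →
    nonempty? B ×-dec B ⊆? S ×-dec all? (λ i → (i ∈? B) →-dec (d B i ≤? lookup P i)))

  -- A singleton suffices: if the entry at i reached b, then `⁅ i ⁆` would be an unstable set. Hence
  -- a box of side b contains every stable vector.
  stable-bounded : ∀ {b} → (∀ A i → d A i ≤ b) → ∀ {P} → Stable ⊤ P → ∀ i → lookup P i < b
  stable-bounded d≤b {P} st i = ℕ.≰⇒> λ b≤ → st (⁅ i ⁆ , (i , x∈⁅x⁆ i) , (λ _ → ∈⊤) , λ j j∈ →
    subst (λ k → d ⁅ i ⁆ k ≤ lookup P k) (sym (x∈⁅y⁆⇒x≡y i j∈)) (ℕ.≤-trans (d≤b ⁅ i ⁆ i) b≤))

  module _ (antitone : ∀ {A B i} → A ⊆ B → i ∈ A → d B i ≤ d A i) (b : ℕ) (d≤b : ∀ A i → d A i ≤ b) where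

    stableCount : Subset N → ℤ
    stableCount S = ∑ (box b S) (λ P → 𝟙 (stable? S P))

    private
      stable-local : ∀ S → LocalOn b S (λ P → 𝟙 (stable? S P))
      stable-local S P Q eq = 𝟙-cong (stable? S P) (stable? S Q) (transfer Q P (sym ∘ eq)) (transfer P Q eq)
        where
        transfer : ∀ P Q → (∀ {i} → i ∈ S → lookup P i ≡ lookup Q i) → Stable S Q → Stable S P
        transfer P Q eq st (B , ne , B⊆S , h) = st (B , ne , B⊆S , λ i i∈ → ℕ.≤-trans (h i i∈) (ℕ.≤-reflexive (eq (B⊆S i∈))))

      -- If every element of S′ ∖ S is below its threshold for S′, then by antitonicity no unstable B ⊆ S′ meets S′ ∖ S.
      stable-⇔ : ∀ S S′ P → links S S′ (below b (d S′) P) * 𝟙 (stable? S P) ≡ links S S′ (below b (d S′) P) * 𝟙 (stable? S′ P)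
      stable-⇔ S S′ P with links S S′ (below b (d S′) P) ℤ.≟ 0ℤ
      ... | yes eq rewrite eq = refl
      ... | no ≢0 = cong (links S S′ (below b (d S′) P) *_) (𝟙-cong (stable? S P) (stable? S′ P)
        (λ st (B , ne , B⊆S′ , h) → st (B , ne , (λ {i} → inS B B⊆S′ h i) , h))
        (λ st (B , ne , B⊆S , h) → st (B , ne , ⊆-trans B⊆S (proj₁ sup) , h)))
        where
        sup : Supported S S′ (below b (d S′) P)
        sup = links-≢0 S S′ _ ≢0

        inS : ∀ B → B ⊆ S′ → (∀ i → i ∈ B → d B i ≤ lookup P i) → ∀ i → i ∈ B → i ∈ S
        inS B B⊆S′ h i i∈ with i ∈? S
        ... | yes i∈S = i∈S
        ... | no i∉S = ⊥-elim (proj₂ sup (B⊆S′ i∈) i∉S (cong -_ (𝟙-false (lookup P i <? d S′ i)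
                (ℕ.≤⇒≯ (ℕ.≤-trans (antitone B⊆S′ i∈) (h i i∈))))))

      below-threshold : ∀ S P → Stable S P → Nonempty S → ∃ λ i → i ∈ S × lookup P i < d S i
      below-threshold S P st ne with any? (λ i → (i ∈? S) ×-dec (lookup P i <? d S i))
      ... | yes p = p
      ... | no ¬p = ⊥-elim (st (S , ne , (λ i∈ → i∈) , λ i i∈ → ℕ.≮⇒≥ λ lt → ¬p (i , i∈ , lt)))

      -- The sum is the expansion of the product of 1 - [P i < d S′ i] over i ∈ S′. For stable P and
      -- nonempty S′ some factor is 0, since otherwise S′ itself would be unstable; for unstable P
      -- the indicator is 0. Only the empty product survives.
      pointwise : ∀ S′ P → ∑ (subsets N) (λ S → links S S′ (below b (d S′) P)) * 𝟙 (stable? S′ P) ≡ 𝟙 (S′ ≟ˢ ⊥)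
      pointwise S′ P with nonempty? S′
      ... | no ¬ne rewrite Empty-unique ¬ne = trans
        (cong₂ _*_ (∑-links-⊥ (below b (d ⊥) P)) (𝟙-true (stable? ⊥ P) λ (B , (i , i∈) , B⊆⊥ , _) → ∉⊥ (B⊆⊥ i∈)))
        (sym (𝟙-true (⊥ {N} ≟ˢ ⊥) refl))
      ... | yes ne = trans (vanish (stable? S′ P)) (sym (𝟙-false (S′ ≟ˢ ⊥) λ eq → ∉⊥ (subst (proj₁ ne ∈_) eq (proj₂ ne))))
        where
        vanish : (st? : Dec (Stable S′ P)) → ∑ (subsets N) (λ S → links S S′ (below b (d S′) P)) * 𝟙 st? ≡ 0ℤ
        vanish (yes st) = let i , i∈ , lt = below-threshold S′ P st ne in
          cong (_* 𝟙 (yes st)) (∑-links-zero S′ _ i∈ (cong -_ (𝟙-true (lookup P i <? d S′ i) lt)))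
        vanish (no ¬st) = trans (cong (∑ (subsets N) (λ S → links S S′ (below b (d S′) P)) *_) (𝟙-false (no ¬st) ¬st)) (ℤ.*-zeroʳ (∑ (subsets N) (λ S → links S S′ (below b (d S′) P))))

      ∑-box-⊥ : ∀ {M} → ∑ (box b (⊥ {M})) (λ _ → 1ℤ) ≡ 1ℤ
      ∑-box-⊥ {zero}  = ∑-[-] [] (λ _ → 1ℤ)
      ∑-box-⊥ {suc M} = trans (∑-map (0 ∷_) (box b (⊥ {M})) _) (∑-box-⊥ {M})

      ∑-box-𝟙 : (S : Subset N) (q : Dec (S ≡ ⊥)) → ∑ (box b S) (λ _ → 𝟙 q) ≡ 𝟙 q
      ∑-box-𝟙 S q@(yes refl) = trans (∑-cong (box b S) λ _ → 𝟙-true q refl) (trans (∑-box-⊥ {N}) (sym (𝟙-true q refl)))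
      ∑-box-𝟙 S q@(no ≢⊥)    = trans (∑-zero (box b S) λ _ → 𝟙-false q ≢⊥) (sym (𝟙-false q ≢⊥))

    -- Double counting over pairs (S , P): summing over P first produces the thresholds by
    -- `∑-box-links`, summing over S first is `pointwise`. The exchange is possible because
    -- `stable-⇔` makes the stability condition the same for all contributing S.
    ∑-stableCount-links : ∀ S′ →
      ∑ (subsets N) (λ S → links S S′ (λ i → - (+ d S′ i)) * stableCount S) ≡ 𝟙 (S′ ≟ˢ ⊥)
    ∑-stableCount-links S′ = begin
      ∑ (subsets N) (λ S → links S S′ (λ i → - (+ d S′ i)) * stableCount S)
        ≡⟨ ∑-cong (subsets N) (λ S → ∑-box-links b S S′ (d S′) (d≤b S′) _ (stable-local S)) ⟨
      ∑ (subsets N) (λ S → ∑ (box b S′) (λ P → links S S′ (below b (d S′) P) * 𝟙 (stable? S P)))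
        ≡⟨ ∑-swap (subsets N) (box b S′) _ ⟩
      ∑ (box b S′) (λ P → ∑ (subsets N) (λ S → links S S′ (below b (d S′) P) * 𝟙 (stable? S P)))
        ≡⟨ ∑-cong (box b S′) (λ P → trans (∑-cong (subsets N) λ S → stable-⇔ S S′ P)
             (trans (∑-*ʳ (subsets N) (𝟙 (stable? S′ P)) _) (pointwise S′ P))) ⟩
      ∑ (box b S′) (λ P → 𝟙 (S′ ≟ˢ ⊥))
        ≡⟨ ∑-box-𝟙 S′ (S′ ≟ˢ ⊥) ⟩
      𝟙 (S′ ≟ˢ ⊥) ∎
      where open ≡-Reasoning

    -- The row vector stableCount and the column vector F solve the two triangular systems with matrix links;
    -- evaluating the product row · matrix · column in both orders compares their extreme entries.
    stableCount-⊤ : (F : Subset N → ℤ) →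
      (∀ S → ∑ (subsets N) (λ S′ → links S S′ (λ i → - (+ d S′ i)) * F S′) ≡ 𝟙 (S ≟ˢ ⊤)) →
      stableCount ⊤ ≡ F ⊥
    stableCount-⊤ F F-eq = begin
      stableCount ⊤
        ≡⟨ ∑-δ-subsets ⊤ stableCount ⟨
      ∑ (subsets N) (λ S → 𝟙 (S ≟ˢ ⊤) * stableCount S)
        ≡⟨ ∑-cong (subsets N) (λ S → cong (_* stableCount S) (F-eq S)) ⟨
      ∑ (subsets N) (λ S → ∑ (subsets N) (λ S′ → L S S′ * F S′) * stableCount S)
        ≡⟨ ∑-cong (subsets N) (λ S → ∑-*ʳ (subsets N) (stableCount S) _) ⟨
      ∑ (subsets N) (λ S → ∑ (subsets N) (λ S′ → L S S′ * F S′ * stableCount S))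
        ≡⟨ ∑-swap (subsets N) (subsets N) _ ⟩
      ∑ (subsets N) (λ S′ → ∑ (subsets N) (λ S → L S S′ * F S′ * stableCount S))
        ≡⟨ ∑-cong (subsets N) (λ S′ → trans (∑-cong (subsets N) λ S → rearrange (L S S′) (F S′) (stableCount S))
             (trans (∑-*ʳ (subsets N) (F S′) _) (cong (_* F S′) (∑-stableCount-links S′)))) ⟩
      ∑ (subsets N) (λ S′ → 𝟙 (S′ ≟ˢ ⊥) * F S′)
        ≡⟨ ∑-δ-subsets ⊥ F ⟩
      F ⊥ ∎
      where
      open ≡-Reasoning
      L : Subset N → Subset N → ℤ
      L S S′ = links S S′ (λ i → - (+ d S′ i))
      rearrange : ∀ x y z → x * y * z ≡ x * z * y
      rearrange = solve-∀

-- Grouping subsets by size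

∑-upTo-suc : ∀ k (f : ℕ → ℤ) → ∑ (upTo (suc k)) f ≡ f 0 + ∑ (upTo k) (f ∘ suc)
∑-upTo-suc k f = begin
  ∑ (upTo (suc k)) f                    ≡⟨ ∑-∷ 0 (applyUpTo suc k) f ⟩
  f 0 + ∑ (applyUpTo suc k) f           ≡⟨ cong (λ xs → f 0 + ∑ xs f) (map-upTo suc k) ⟨
  f 0 + ∑ (map suc (upTo k)) f          ≡⟨ cong (λ z → f 0 + z) (∑-map suc (upTo k) f) ⟩
  f 0 + ∑ (upTo k) (f ∘ suc) ∎
  where open ≡-Reasoning

∑-upTo-shift : ∀ k (f : ℕ → ℤ) → ∑ (upTo k) f + f k ≡ f 0 + ∑ (upTo k) (f ∘ suc)
∑-upTo-shift zero    f = trans (cong (λ z → z + f 0) (∑-[] f))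
  (trans (ℤ.+-comm 0ℤ (f 0)) (cong (λ z → f 0 + z) (sym (∑-[] (f ∘ suc)))))
∑-upTo-shift (suc k) f = begin
  ∑ (upTo (suc k)) f + f (suc k)                  ≡⟨ cong (λ z → z + f (suc k)) (∑-upTo-suc k f) ⟩
  f 0 + ∑ (upTo k) (f ∘ suc) + f (suc k)          ≡⟨ ℤ.+-assoc (f 0) _ _ ⟩
  f 0 + (∑ (upTo k) (f ∘ suc) + f (suc k))        ≡⟨ cong (λ z → f 0 + z) (∑-upTo-shift k (f ∘ suc)) ⟩
  f 0 + (f 1 + ∑ (upTo k) (λ i → f (suc (suc i))))        ≡⟨ cong (λ z → f 0 + z) (∑-upTo-suc k (f ∘ suc)) ⟨
  f 0 + ∑ (upTo (suc k)) (f ∘ suc) ∎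
  where open ≡-Reasoning

∑-δ-upTo : ∀ {j b} → j < b → (f : ℕ → ℤ) → ∑ (upTo b) (λ k → 𝟙 (k ≟ j) * f k) ≡ f j
∑-δ-upTo j<b = ∑-δ _≟_ (Uniqueₚ.upTo⁺ _) (∈-upTo⁺ j<b)

opaque
  -- The weighted number of supersets of size k of an s-element subset of an m-element set.
  β : (m s k : ℕ) → ℤ → ℤ
  β m s k x = 𝟙 (s ≤? k) * (+ ((m ∸ s) C (k ∸ s)) * x ^ (k ∸ s))

  β-def : ∀ m s k x → β m s k x ≡ 𝟙 (s ≤? k) * (+ ((m ∸ s) C (k ∸ s)) * x ^ (k ∸ s))
  β-def m s k x = refl

  β-≤ : ∀ m {s k} → s ≤ k → ∀ x → β m s k x ≡ + ((m ∸ s) C (k ∸ s)) * x ^ (k ∸ s)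
  β-≤ m {s} {k} s≤k x = trans (cong (_* y) (𝟙-true (s ≤? k) s≤k)) (ℤ.*-identityˡ y)
    where
    y : ℤ
    y = + ((m ∸ s) C (k ∸ s)) * x ^ (k ∸ s)

  β-≰ : ∀ m {s k} → ¬ s ≤ k → ∀ x → β m s k x ≡ 0ℤ
  β-≰ m {s} {k} s≰k x = cong (_* (+ ((m ∸ s) C (k ∸ s)) * x ^ (k ∸ s))) (𝟙-false (s ≤? k) s≰k)

  β-suc-suc : ∀ m s k x → β (suc m) (suc s) (suc k) x ≡ β m s k x
  β-suc-suc m s k x = cong (_* (+ ((m ∸ s) C (k ∸ s)) * x ^ (k ∸ s))) (𝟙-cong (suc s ≤? suc k) (s ≤? k) ℕ.s≤s⁻¹ s≤s)

nC0≡1 : ∀ n → n C 0 ≡ 1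
nC0≡1 n = trans (nCk≡nC[n∸k] {n = n} z≤n) (nCn≡1 n)

β-diag : ∀ m s x → β m s s x ≡ 1ℤ
β-diag m s x = trans (β-≤ m (ℕ.≤-refl {s}) x)
  (cong₂ (λ c e → + c * x ^ e) (trans (cong ((m ∸ s) C_) (ℕ.n∸n≡0 s)) (nC0≡1 (m ∸ s))) (ℕ.n∸n≡0 s))

-- The new ground element lies outside the fixed s-element subset; a superset of size k + 1 either
-- avoids it or contains it at the price of a factor x.
β-pascal : ∀ m s k x → s ≤ m → β (suc m) s (suc k) x ≡ β m s (suc k) x + x * β m s k x
β-pascal m s k x s≤m with ℕ.<-cmp s (suc k)
... | tri< (s≤s s≤k) _ _ = begin
  β (suc m) s (suc k) x
    ≡⟨ β-≤ (suc m) (ℕ.m≤n⇒m≤1+n s≤k) x ⟩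
  + ((suc m ∸ s) C (suc k ∸ s)) * x ^ (suc k ∸ s)
    ≡⟨ cong₂ (λ p q → + (p C q) * x ^ q) (ℕ.+-∸-assoc 1 s≤m) (ℕ.+-∸-assoc 1 s≤k) ⟩
  + (suc M C suc j) * (x * x ^ j)
    ≡⟨ cong (λ c → + c * (x * x ^ j)) (nCk+nC[k+1]≡[n+1]C[k+1] M j) ⟨
  (+ (M C j) + + (M C suc j)) * (x * x ^ j)
    ≡⟨ expand (+ (M C j)) (+ (M C suc j)) x (x ^ j) ⟩
  + (M C suc j) * (x ^ suc j) + x * (+ (M C j) * x ^ j)
    ≡⟨ cong₂ (λ p q → p + x * q)
         (trans (β-≤ m (ℕ.m≤n⇒m≤1+n s≤k) x) (cong (λ q → + (M C q) * x ^ q) (ℕ.+-∸-assoc 1 s≤k))) (β-≤ m s≤k x) ⟨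
  β m s (suc k) x + x * β m s k x ∎
  where
  open ≡-Reasoning
  M j : ℕ
  M = m ∸ s
  j = k ∸ s
  expand : ∀ a b x y → (a + b) * (x * y) ≡ b * (x * y) + x * (a * y)
  expand = solve-∀
-- Here `k ∸ s` truncates to 0, so without the indicator in `β` the last term would be x instead of
-- 0.
... | tri≈ _ refl _ = trans (β-diag (suc m) (suc k) x) (sym (trans
  (cong₂ (λ p q → p + x * q) (β-diag m (suc k) x) (β-≰ m (ℕ.<-irrefl refl) x)) (cong (λ z → 1ℤ + z) (ℤ.*-zeroʳ x))))
... | tri> _ _ k<s = trans (β-≰ (suc m) (ℕ.<⇒≱ k<s) x) (sym (trans
  (cong₂ (λ p q → p + x * q) (β-≰ m (ℕ.<⇒≱ k<s) x) (β-≰ m (ℕ.<⇒≱ (ℕ.<-trans (ℕ.n<1+n k) k<s)) x))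
  (cong (λ z → 0ℤ + z) (ℤ.*-zeroʳ x))))


-- Induction on the ground set, deciding whether the head belongs to S′. For a head outside S the
-- two choices are the two summands of `β-pascal`; a head inside S is forced into S′.
∑-links-size : ∀ {m} (S : Subset m) k (x : ℤ) →
  ∑ (subsets m) (λ S′ → 𝟙 (k ≟ ∣ S′ ∣) * links S S′ (λ _ → x)) ≡ β m ∣ S ∣ k x
∑-links-size [] zero x = trans (∑-[-] [] _) (trans (cong (_* 1ℤ) (𝟙-true (0 ≟ 0) refl)) (sym (β-diag 0 0 x)))
∑-links-size [] (suc k) x = trans (∑-[-] [] _) (trans (cong (_* 1ℤ) (𝟙-false (suc k ≟ 0) λ ()))
  (sym (trans (β-≤ 0 {0} {suc k} z≤n x) (cong (λ c → + c * x ^ suc k) (k>n⇒nCk≡0 {0} {suc k} (s≤s z≤n))))))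
∑-links-size {suc m} (c ∷ S) k x = trans (∑-subsets-suc _) (split c k)
  where
  term : Bool → ℕ → Bool → Subset m → ℤ
  term c k c′ S′ = 𝟙 (k ≟ ∣ c′ ∷ S′ ∣) * (link c c′ x * links S S′ (λ _ → x))

  pull : ∀ c k c′ k′ → (∀ S′ → 𝟙 (k ≟ ∣ c′ ∷ S′ ∣) ≡ 𝟙 (k′ ≟ ∣ S′ ∣)) →
         ∑ (subsets m) (term c k c′) ≡ link c c′ x * β m ∣ S ∣ k′ x
  pull c k c′ k′ eq = trans
    (∑-cong (subsets m) λ S′ → trans (cong (_* (link c c′ x * links S S′ (λ _ → x))) (eq S′))
      (swap (𝟙 (k′ ≟ ∣ S′ ∣)) (link c c′ x) (links S S′ (λ _ → x))))
    (trans (∑-*ˡ (subsets m) (link c c′ x) _) (cong (link c c′ x *_) (∑-links-size S k′ x)))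
    where
    swap : ∀ a b c → a * (b * c) ≡ b * (a * c)
    swap = solve-∀

  insideZero : ∀ c → ∑ (subsets m) (term c 0 inside) ≡ 0ℤ
  insideZero c = ∑-zero (subsets m) λ S′ →
    cong (_* (link c inside x * links S S′ (λ _ → x))) (𝟙-false (0 ≟ suc ∣ S′ ∣) λ ())

  insideSuc : ∀ c k → ∑ (subsets m) (term c (suc k) inside) ≡ link c inside x * β m ∣ S ∣ k x
  insideSuc c k = pull c (suc k) inside k λ S′ → 𝟙-cong (suc k ≟ suc ∣ S′ ∣) (k ≟ ∣ S′ ∣) ℕ.suc-injective (cong suc)

  β-zero : ∀ s → β (suc m) s 0 x ≡ β m s 0 x
  β-zero zero    = trans (β-diag (suc m) 0 x) (sym (β-diag m 0 x))
  β-zero (suc s) = trans (β-≰ (suc m) {suc s} {0} (λ ()) x) (sym (β-≰ m {suc s} {0} (λ ()) x))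

  split : ∀ c k → ∑ (subsets m) (term c k outside) + ∑ (subsets m) (term c k inside) ≡ β (suc m) ∣ c ∷ S ∣ k x
  split outside zero = trans (cong₂ _+_ (pull outside 0 outside 0 λ _ → refl) (insideZero outside))
    (trans (ℤ.+-identityʳ (1ℤ * β m ∣ S ∣ 0 x)) (trans (ℤ.*-identityˡ (β m ∣ S ∣ 0 x)) (sym (β-zero ∣ S ∣))))
  split outside (suc k) = trans (cong₂ _+_ (pull outside (suc k) outside (suc k) λ _ → refl) (insideSuc outside k))
    (trans (cong (λ z → z + x * β m ∣ S ∣ k x) (ℤ.*-identityˡ (β m ∣ S ∣ (suc k) x))) (sym (β-pascal m ∣ S ∣ k x (∣p∣≤n S))))
  split inside zero = trans (cong₂ _+_ (pull inside 0 outside 0 λ _ → refl) (insideZero inside))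
    (sym (β-≰ (suc m) {suc ∣ S ∣} {0} (λ ()) x))
  split inside (suc k) = trans (cong₂ _+_ (pull inside (suc k) outside (suc k) λ _ → refl) (insideSuc inside k))
    (trans (ℤ.+-identityˡ (1ℤ * β m ∣ S ∣ k x)) (trans (ℤ.*-identityˡ (β m ∣ S ∣ k x)) (sym (β-suc-suc m ∣ S ∣ k x))))

-- The weight x depends on S′ through its size. Inserting a sum over k with a delta at that size
-- makes the weight constant in each inner sum, where `∑-links-size` applies.
∑-links-group : ∀ {m b} (S : Subset m) (x φ : ℕ → ℤ) → m < b →
  ∑ (subsets m) (λ S′ → links S S′ (λ _ → x ∣ S′ ∣) * φ ∣ S′ ∣) ≡ ∑ (upTo b) (λ k → β m ∣ S ∣ k (x k) * φ k)
∑-links-group {m} {b} S x φ m<b = begin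
  ∑ (subsets m) (λ S′ → links S S′ (λ _ → x ∣ S′ ∣) * φ ∣ S′ ∣)
    ≡⟨ ∑-cong (subsets m) (λ S′ → ∑-δ-upTo (ℕ.≤-<-trans (∣p∣≤n S′) m<b) (λ k → links S S′ (λ _ → x k) * φ k)) ⟨
  ∑ (subsets m) (λ S′ → ∑ (upTo b) (λ k → 𝟙 (k ≟ ∣ S′ ∣) * (links S S′ (λ _ → x k) * φ k)))
    ≡⟨ ∑-swap (subsets m) (upTo b) _ ⟩
  ∑ (upTo b) (λ k → ∑ (subsets m) (λ S′ → 𝟙 (k ≟ ∣ S′ ∣) * (links S S′ (λ _ → x k) * φ k)))
    ≡⟨ ∑-cong (upTo b) (λ k → trans
         (∑-cong (subsets m) λ S′ → sym (ℤ.*-assoc (𝟙 (k ≟ ∣ S′ ∣)) (links S S′ (λ _ → x k)) (φ k)))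
         (trans (∑-*ʳ (subsets m) (φ k) _) (cong (_* φ k) (∑-links-size S k (x k))))) ⟩
  ∑ (upTo b) (λ k → β m ∣ S ∣ k (x k) * φ k) ∎
  where open ≡-Reasoning

-- Both weights involve both sizes, so the double sum is not a product of two sums. One part is
-- grouped while the subset of the other is held fixed, and its factor is carried along inside φ.
∑-links-group₂ : ∀ {m n b} (S : Subset m) (T : Subset n) (x y F : ℕ → ℕ → ℤ) → m < b → n < b →
  ∑ (subsets m) (λ S′ → ∑ (subsets n) (λ T′ →
    links S S′ (λ _ → x (∣ S′ ∣) (∣ T′ ∣)) * links T T′ (λ _ → y (∣ S′ ∣) (∣ T′ ∣)) * F (∣ S′ ∣) (∣ T′ ∣))) ≡
  ∑ (upTo b) (λ s → ∑ (upTo b) (λ t → β m (∣ S ∣) s (x s t) * β n (∣ T ∣) t (y s t) * F s t))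
∑-links-group₂ {m} {n} {b} S T x y F m<b n<b = begin
  ∑ (subsets m) (λ S′ → ∑ (subsets n) (λ T′ → lS S′ (∣ T′ ∣) * lT (∣ S′ ∣) T′ * F (∣ S′ ∣) (∣ T′ ∣)))
    ≡⟨ ∑-cong (subsets m) (λ S′ → trans
         (∑-cong (subsets n) λ T′ → front (lS S′ (∣ T′ ∣)) (lT (∣ S′ ∣) T′) (F (∣ S′ ∣) (∣ T′ ∣)))
         (∑-links-group T (y (∣ S′ ∣)) (λ t → lS S′ t * F (∣ S′ ∣) t) n<b)) ⟩
  ∑ (subsets m) (λ S′ → ∑ (upTo b) (λ t → βT (∣ S′ ∣) t * (lS S′ t * F (∣ S′ ∣) t)))
    ≡⟨ ∑-swap (subsets m) (upTo b) _ ⟩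
  ∑ (upTo b) (λ t → ∑ (subsets m) (λ S′ → βT (∣ S′ ∣) t * (lS S′ t * F (∣ S′ ∣) t)))
    ≡⟨ ∑-cong (upTo b) (λ t → trans
         (∑-cong (subsets m) λ S′ → swap (βT (∣ S′ ∣) t) (lS S′ t) (F (∣ S′ ∣) t))
         (∑-links-group S (λ s → x s t) (λ s → βT s t * F s t) m<b)) ⟩
  ∑ (upTo b) (λ t → ∑ (upTo b) (λ s → β m (∣ S ∣) s (x s t) * (βT s t * F s t)))
    ≡⟨ ∑-swap (upTo b) (upTo b) _ ⟩
  ∑ (upTo b) (λ s → ∑ (upTo b) (λ t → β m (∣ S ∣) s (x s t) * (βT s t * F s t)))
    ≡⟨ ∑-cong (upTo b) (λ s → ∑-cong (upTo b) λ t → sym (ℤ.*-assoc (β m (∣ S ∣) s (x s t)) (βT s t) (F s t))) ⟩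
  ∑ (upTo b) (λ s → ∑ (upTo b) (λ t → β m (∣ S ∣) s (x s t) * βT s t * F s t)) ∎
  where
  open ≡-Reasoning
  lS : Subset m → ℕ → ℤ
  lS S′ t = links S S′ (λ _ → x (∣ S′ ∣) t)
  lT : ℕ → Subset n → ℤ
  lT s T′ = links T T′ (λ _ → y s (∣ T′ ∣))
  βT : ℕ → ℕ → ℤ
  βT s t = β n (∣ T ∣) t (y s t)
  front : ∀ a b c → a * b * c ≡ b * (a * c)
  front = solve-∀
  swap : ∀ a b c → a * (b * c) ≡ b * (a * c)
  swap = solve-∀

-- Signed sums over walks

module Walks (m n : ℕ) where

  -- A common strict bound for the sizes s and t, for the entries of stable vectors and for the
  -- lengths of walks, all of which are at most m + n.
  b : ℕ
  b = suc (m ℕ.+ n)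

  Kernel : Set
  Kernel = ℕ → ℕ → ℕ → ℕ → ℤ

  ∑∑ : (ℕ → ℕ → ℤ) → ℤ
  ∑∑ f = ∑ (upTo b) λ s → ∑ (upTo b) λ t → f s t

  ∑∑-cong : ∀ {f g : ℕ → ℕ → ℤ} → (∀ s t → f s t ≡ g s t) → ∑∑ f ≡ ∑∑ g
  ∑∑-cong eq = ∑-cong (upTo b) λ s → ∑-cong (upTo b) λ t → eq s t

  ∑∑-zero : ∀ {f : ℕ → ℕ → ℤ} → (∀ s t → f s t ≡ 0ℤ) → ∑∑ f ≡ 0ℤ
  ∑∑-zero eq = ∑-zero (upTo b) λ s → ∑-zero (upTo b) λ t → eq s t

  ∑∑-+ : ∀ (f g : ℕ → ℕ → ℤ) → ∑∑ (λ s t → f s t + g s t) ≡ ∑∑ f + ∑∑ g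
  ∑∑-+ f g = trans (∑-cong (upTo b) λ s → ∑-+ (upTo b) (f s) (g s)) (∑-+ (upTo b) _ _)

  ∑∑-*ˡ : ∀ k (f : ℕ → ℕ → ℤ) → ∑∑ (λ s t → k * f s t) ≡ k * ∑∑ f
  ∑∑-*ˡ k f = trans (∑-cong (upTo b) λ s → ∑-*ˡ (upTo b) k (f s)) (∑-*ˡ (upTo b) k _)

  ∑∑-∑ : ∀ {A : Set} (xs : List A) (f : A → ℕ → ℕ → ℤ) →
         ∑∑ (λ s t → ∑ xs (λ x → f x s t)) ≡ ∑ xs (λ x → ∑∑ (f x))
  ∑∑-∑ xs f = trans (∑-cong (upTo b) λ s → ∑-swap (upTo b) xs _) (∑-swap (upTo b) xs _)

  end : ℕ → ℕ → ℤ
  end s t = 𝟙 ((s ≟ m) ×-dec (t ≟ n))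

  -- The i-th power of the matrix K applied to the unit vector `end` at the state (m , n).
  walk : Kernel → ℕ → ℕ → ℕ → ℤ
  walk K zero    s t = end s t
  walk K (suc i) s t = ∑∑ λ s′ t′ → K s t s′ t′ * walk K i s′ t′

  -- The family d of the header, for A meeting the two parts in s and t vertices.
  dˡ dʳ : ℕ → ℕ → ℕ
  dˡ s t = if does ((s <? m) ×-dec (t <? n)) then n ∸ t else 1
  dʳ s t = if does ((s <? m) ×-dec (t <? n)) then m ∸ s else 1

  -- The matrix of `stableCount-⊤` collapsed from subsets to pairs of sizes. The weights are
  -- evaluated at the target (s′ , t′) because the thresholds belong to the larger set.
  transfer : Kernel
  transfer s t s′ t′ = β m s s′ (- + dˡ s′ t′) * β n t t′ (- + dʳ s′ t′)

  -- `signedStep` is the identity minus `transfer`: the condition s + t < s′ + t′ removes exactly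
  -- the diagonal. `step` carries the same entries without signs, as they occur in the multinomial
  -- coefficients and μ.
  step signedStep : Kernel
  step s t s′ t′       = 𝟙 (s ℕ.+ t <? s′ ℕ.+ t′) * (β m s s′ (+ dˡ s′ t′) * β n t t′ (+ dʳ s′ t′))
  signedStep s t s′ t′ = - (𝟙 (s ℕ.+ t <? s′ ℕ.+ t′) * transfer s t s′ t′)

  -- Nilpotency: every step with a nonzero entry raises s + t by at least 1, while a walk that
  -- counts has to end at total m + n.
  walk-vanish : ∀ i s t → m ℕ.+ n < s ℕ.+ t ℕ.+ i → walk signedStep i s t ≡ 0ℤ
  walk-vanish zero s t lt = 𝟙-false ((s ≟ m) ×-dec (t ≟ n)) λ { (refl , refl) →
    ℕ.<-irrefl refl (subst (m ℕ.+ n <_) (ℕ.+-identityʳ (m ℕ.+ n)) lt) }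
  walk-vanish (suc i) s t lt = ∑∑-zero λ s′ t′ → go s′ t′ (s ℕ.+ t <? s′ ℕ.+ t′)
    where
    go : ∀ s′ t′ → Dec (s ℕ.+ t < s′ ℕ.+ t′) → signedStep s t s′ t′ * walk signedStep i s′ t′ ≡ 0ℤ
    go s′ t′ (yes p) = trans (cong (signedStep s t s′ t′ *_) (walk-vanish i s′ t′
      (ℕ.<-≤-trans lt (ℕ.≤-trans (ℕ.≤-reflexive (ℕ.+-suc (s ℕ.+ t) i)) (ℕ.+-monoˡ-≤ i p)))))
      (ℤ.*-zeroʳ (signedStep s t s′ t′))
    go s′ t′ (no ¬p) = cong (λ z → - (z * transfer s t s′ t′) * walk signedStep i s′ t′)
      (𝟙-false (s ℕ.+ t <? s′ ℕ.+ t′) ¬p)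

  -- The Neumann series for the inverse of `transfer`, applied to `end`; by `walk-vanish` the
  -- lengths below b are all that contribute.
  potential : ℕ → ℕ → ℤ
  potential s t = ∑ (upTo b) λ i → walk signedStep i s t

  private
    -- `β` vanishes unless s ≤ s′ and t ≤ t′. Under these inequalities the total fails to grow only
    -- if both sizes stay the same, and there `β` is 1.
    diagonal : ∀ s t s′ t′ → (1ℤ + - 𝟙 (s ℕ.+ t <? s′ ℕ.+ t′)) * transfer s t s′ t′ ≡ 𝟙 (s′ ≟ s) * 𝟙 (t′ ≟ t)
    diagonal s t s′ t′ with s ≤? s′ | t ≤? t′
    ... | no s≰ | _ = trans (cong (λ z → (1ℤ + - 𝟙 (s ℕ.+ t <? s′ ℕ.+ t′)) * (z * β n t t′ (- + dʳ s′ t′))) (β-≰ m s≰ (- + dˡ s′ t′)))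
      (trans (ℤ.*-zeroʳ (1ℤ + - 𝟙 (s ℕ.+ t <? s′ ℕ.+ t′)))
        (sym (cong (_* 𝟙 (t′ ≟ t)) (𝟙-false (s′ ≟ s) λ { refl → s≰ ℕ.≤-refl }))))
    ... | yes _ | no t≰ = trans (cong (λ z → (1ℤ + - 𝟙 (s ℕ.+ t <? s′ ℕ.+ t′)) * (β m s s′ (- + dˡ s′ t′) * z)) (β-≰ n t≰ (- + dʳ s′ t′)))
      (trans (zero₂ (1ℤ + - 𝟙 (s ℕ.+ t <? s′ ℕ.+ t′)) (β m s s′ (- + dˡ s′ t′)))
        (sym (trans (cong (𝟙 (s′ ≟ s) *_) (𝟙-false (t′ ≟ t) λ { refl → t≰ ℕ.≤-refl })) (ℤ.*-zeroʳ (𝟙 (s′ ≟ s))))))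
      where
      zero₂ : ∀ a b → a * (b * 0ℤ) ≡ 0ℤ
      zero₂ = solve-∀
    ... | yes s≤ | yes t≤ with s′ ≟ s | t′ ≟ t
    ...   | yes refl | yes refl = trans
      (cong₂ (λ p q → (1ℤ + - p) * q) (𝟙-false (s ℕ.+ t <? s ℕ.+ t) (ℕ.<-irrefl refl))
        (cong₂ _*_ (β-diag m s (- + dˡ s t)) (β-diag n t (- + dʳ s t))))
      (sym (cong₂ _*_ (𝟙-true (yes refl) refl) (𝟙-true (yes refl) refl)))
    ...   | yes refl | no t≢ = trans
      (cong (λ p → (1ℤ + - p) * transfer s t s t′) (𝟙-true (s ℕ.+ t <? s ℕ.+ t′) (ℕ.+-monoʳ-< s (ℕ.≤∧≢⇒< t≤ (t≢ ∘ sym)))))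
      (sym (trans (cong (𝟙 (yes refl) *_) (𝟙-false (no t≢) t≢)) (ℤ.*-zeroʳ (𝟙 (yes (refl {x = s}))))))
    ...   | no s≢ | t≟ = trans
      (cong (λ p → (1ℤ + - p) * transfer s t s′ t′) (𝟙-true (s ℕ.+ t <? s′ ℕ.+ t′) (ℕ.+-mono-<-≤ (ℕ.≤∧≢⇒< s≤ (s≢ ∘ sym)) t≤)))
      (sym (cong (_* 𝟙 t≟) (𝟙-false (no s≢) s≢)))

  ∑∑-δ : ∀ {s t} → s < b → t < b → (f : ℕ → ℕ → ℤ) → ∑∑ (λ s′ t′ → 𝟙 (s′ ≟ s) * 𝟙 (t′ ≟ t) * f s′ t′) ≡ f s t
  ∑∑-δ {s} {t} s<b t<b f = trans
    (∑-cong (upTo b) λ s′ → trans (∑-cong (upTo b) λ t′ → ℤ.*-assoc (𝟙 (s′ ≟ s)) (𝟙 (t′ ≟ t)) (f s′ t′))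
      (trans (∑-*ˡ (upTo b) (𝟙 (s′ ≟ s)) _) (cong (𝟙 (s′ ≟ s) *_) (∑-δ-upTo t<b (f s′)))))
    (∑-δ-upTo s<b λ s′ → f s′ t)

  -- Telescoping: with `transfer` written as the identity minus `signedStep`, the series and its
  -- shift cancel except for the term `end` of length 0 and the term of length b, which vanishes.
  ∑∑-transfer-potential : ∀ {s t} → s < b → t < b →
    ∑∑ (λ s′ t′ → transfer s t s′ t′ * potential s′ t′) ≡ end s t
  ∑∑-transfer-potential {s} {t} s<b t<b = begin
    ∑∑ (λ s′ t′ → transfer s t s′ t′ * potential s′ t′)
      ≡⟨ ∑∑-cong (λ s′ t′ → split (𝟙 (s ℕ.+ t <? s′ ℕ.+ t′)) (transfer s t s′ t′) (potential s′ t′)) ⟩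
    ∑∑ (λ s′ t′ → (1ℤ + - 𝟙 (s ℕ.+ t <? s′ ℕ.+ t′)) * transfer s t s′ t′ * potential s′ t′ + -1ℤ * (signedStep s t s′ t′ * potential s′ t′))
      ≡⟨ ∑∑-+ _ _ ⟩
    ∑∑ (λ s′ t′ → (1ℤ + - 𝟙 (s ℕ.+ t <? s′ ℕ.+ t′)) * transfer s t s′ t′ * potential s′ t′) + ∑∑ (λ s′ t′ → -1ℤ * (signedStep s t s′ t′ * potential s′ t′))
      ≡⟨ cong₂ _+_
           (trans (∑∑-cong λ s′ t′ → cong (_* potential s′ t′) (diagonal s t s′ t′)) (∑∑-δ s<b t<b potential))
           (trans (∑∑-*ˡ -1ℤ _) (cong (-1ℤ *_) (trans
             (∑∑-cong λ s′ t′ → sym (∑-*ˡ (upTo b) (signedStep s t s′ t′) (λ i → walk signedStep i s′ t′)))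
             (∑∑-∑ (upTo b) λ i s′ t′ → signedStep s t s′ t′ * walk signedStep i s′ t′)))) ⟩
    potential s t + -1ℤ * ∑ (upTo b) (λ i → walk signedStep (suc i) s t)
      ≡⟨ cancel (potential s t) (walk signedStep b s t) (end s t) (∑ (upTo b) (λ i → walk signedStep (suc i) s t))
           (∑-upTo-shift b (λ i → walk signedStep i s t)) (walk-vanish b s t (ℕ.m≤n+m b (s ℕ.+ t))) ⟩
    end s t ∎
    where
    open ≡-Reasoning
    split : ∀ a q f → q * f ≡ (1ℤ + - a) * q * f + -1ℤ * (- (a * q) * f)
    split = solve-∀
    cancel : ∀ p w e q → p + w ≡ e + q → w ≡ 0ℤ → p + -1ℤ * q ≡ e
    cancel p w e q eq refl = begin
      p + -1ℤ * q        ≡⟨ cong (λ z → z + -1ℤ * q) (ℤ.+-identityʳ p) ⟨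
      p + 0ℤ + -1ℤ * q   ≡⟨ cong (λ z → z + -1ℤ * q) eq ⟩
      e + q + -1ℤ * q    ≡⟨ simp e q ⟩
      e ∎
      where
      simp : ∀ e q → e + q + -1ℤ * q ≡ e
      simp = solve-∀

  -- Replacing - x by x costs one sign for each of the s′ - s added elements. With the powers of -1
  -- placed at the two endpoints, the signs of consecutive steps telescope along a walk.
  β-sign : ∀ k s s′ x → β k s s′ (- x) * -1ℤ ^ s ≡ β k s s′ x * -1ℤ ^ s′
  β-sign k s s′ x with s ≤? s′
  ... | no s≰ = trans (cong (_* -1ℤ ^ s) (β-≰ k s≰ (- x))) (sym (cong (_* -1ℤ ^ s′) (β-≰ k s≰ x)))
  ... | yes s≤ = begin
    β k s s′ (- x) * -1ℤ ^ s             ≡⟨ cong (_* -1ℤ ^ s) (β-≤ k s≤ (- x)) ⟩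
    + c * (- x) ^ δ * -1ℤ ^ s            ≡⟨ cong (λ z → + c * z * -1ℤ ^ s) (neg-^ δ) ⟩
    + c * (-1ℤ ^ δ * x ^ δ) * -1ℤ ^ s    ≡⟨ rearrange (+ c) (-1ℤ ^ δ) (x ^ δ) (-1ℤ ^ s) ⟩
    + c * x ^ δ * (-1ℤ ^ δ * -1ℤ ^ s)    ≡⟨ cong (+ c * x ^ δ *_) (ℤ.^-distribˡ-+-* -1ℤ δ s) ⟨
    + c * x ^ δ * -1ℤ ^ (δ ℕ.+ s)        ≡⟨ cong₂ (λ p q → p * -1ℤ ^ q) (sym (β-≤ k s≤ x)) (ℕ.m∸n+n≡m s≤) ⟩
    β k s s′ x * -1ℤ ^ s′ ∎
    where
    open ≡-Reasoning
    c δ : ℕ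
    c = (k ∸ s) C (s′ ∸ s)
    δ = s′ ∸ s
    neg-^ : ∀ j → (- x) ^ j ≡ -1ℤ ^ j * x ^ j
    neg-^ zero    = refl
    neg-^ (suc j) = trans (cong (- x *_) (neg-^ j)) (eq x (-1ℤ ^ j) (x ^ j))
      where
      eq : ∀ x a b → - x * (a * b) ≡ -1ℤ * a * (x * b)
      eq = solve-∀
    rearrange : ∀ c a b d → c * (a * b) * d ≡ c * b * (a * d)
    rearrange = solve-∀

  step-sign : ∀ s t s′ t′ → signedStep s t s′ t′ * -1ℤ ^ (s ℕ.+ t) ≡ -1ℤ * (step s t s′ t′ * -1ℤ ^ (s′ ℕ.+ t′))
  step-sign s t s′ t′ = begin
    - (δ * (β m s s′ (- x) * β n t t′ (- y))) * -1ℤ ^ (s ℕ.+ t)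
      ≡⟨ cong (- (δ * (β m s s′ (- x) * β n t t′ (- y))) *_) (ℤ.^-distribˡ-+-* -1ℤ s t) ⟩
    - (δ * (β m s s′ (- x) * β n t t′ (- y))) * (-1ℤ ^ s * -1ℤ ^ t)
      ≡⟨ r₁ δ (β m s s′ (- x)) (β n t t′ (- y)) (-1ℤ ^ s) (-1ℤ ^ t) ⟩
    -1ℤ * (δ * ((β m s s′ (- x) * -1ℤ ^ s) * (β n t t′ (- y) * -1ℤ ^ t)))
      ≡⟨ cong₂ (λ p q → -1ℤ * (δ * (p * q))) (β-sign m s s′ x) (β-sign n t t′ y) ⟩
    -1ℤ * (δ * ((β m s s′ x * -1ℤ ^ s′) * (β n t t′ y * -1ℤ ^ t′)))
      ≡⟨ r₂ δ (β m s s′ x) (β n t t′ y) (-1ℤ ^ s′) (-1ℤ ^ t′) ⟩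
    -1ℤ * (step s t s′ t′ * (-1ℤ ^ s′ * -1ℤ ^ t′))
      ≡⟨ cong (λ z → -1ℤ * (step s t s′ t′ * z)) (ℤ.^-distribˡ-+-* -1ℤ s′ t′) ⟨
    -1ℤ * (step s t s′ t′ * -1ℤ ^ (s′ ℕ.+ t′)) ∎
    where
    open ≡-Reasoning
    δ x y : ℤ
    δ = 𝟙 (s ℕ.+ t <? s′ ℕ.+ t′)
    x = + dˡ s′ t′
    y = + dʳ s′ t′
    r₁ : ∀ δ p q u v → - (δ * (p * q)) * (u * v) ≡ -1ℤ * (δ * ((p * u) * (q * v)))
    r₁ = solve-∀
    r₂ : ∀ δ p q u v → -1ℤ * (δ * ((p * u) * (q * v))) ≡ -1ℤ * (δ * (p * q) * (u * v))
    r₂ = solve-∀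

  -- The signs at intermediate states cancel. What is left is -1 for each of the i steps and the two
  -- endpoint signs, the one at the end being (-1)^(m + n) since only (m , n) is accepted there.
  walk-sign : ∀ i s t → walk signedStep i s t * -1ℤ ^ (s ℕ.+ t) ≡ -1ℤ ^ (i ℕ.+ (m ℕ.+ n)) * walk step i s t
  walk-sign zero s t with (s ≟ m) ×-dec (t ≟ n)
  ... | yes (refl , refl) = ℤ.*-comm (𝟙 (yes (refl {x = s} , refl {x = t}))) _
  ... | no ¬p = trans (cong (_* -1ℤ ^ (s ℕ.+ t)) (𝟙-false (no ¬p) ¬p))
    (sym (trans (cong (-1ℤ ^ (m ℕ.+ n) *_) (𝟙-false (no ¬p) ¬p)) (ℤ.*-zeroʳ (-1ℤ ^ (m ℕ.+ n)))))
  walk-sign (suc i) s t = begin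
    ∑∑ (λ s′ t′ → signedStep s t s′ t′ * walk signedStep i s′ t′) * σ
      ≡⟨ trans (ℤ.*-comm (∑∑ _) σ) (sym (∑∑-*ˡ σ _)) ⟩
    ∑∑ (λ s′ t′ → σ * (signedStep s t s′ t′ * walk signedStep i s′ t′))
      ≡⟨ ∑∑-cong (λ s′ t′ → begin
           σ * (signedStep s t s′ t′ * walk signedStep i s′ t′)
             ≡⟨ r₁ σ (signedStep s t s′ t′) (walk signedStep i s′ t′) ⟩
           signedStep s t s′ t′ * σ * walk signedStep i s′ t′
             ≡⟨ cong (_* walk signedStep i s′ t′) (step-sign s t s′ t′) ⟩
           -1ℤ * (step s t s′ t′ * -1ℤ ^ (s′ ℕ.+ t′)) * walk signedStep i s′ t′
             ≡⟨ r₂ (step s t s′ t′) (-1ℤ ^ (s′ ℕ.+ t′)) (walk signedStep i s′ t′) ⟩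
           -1ℤ * (step s t s′ t′ * (walk signedStep i s′ t′ * -1ℤ ^ (s′ ℕ.+ t′)))
             ≡⟨ cong (λ z → -1ℤ * (step s t s′ t′ * z)) (walk-sign i s′ t′) ⟩
           -1ℤ * (step s t s′ t′ * (τ * walk step i s′ t′))
             ≡⟨ r₃ (step s t s′ t′) τ (walk step i s′ t′) ⟩
           -1ℤ * τ * (step s t s′ t′ * walk step i s′ t′) ∎) ⟩
    ∑∑ (λ s′ t′ → -1ℤ * τ * (step s t s′ t′ * walk step i s′ t′))
      ≡⟨ ∑∑-*ˡ (-1ℤ * τ) _ ⟩
    -1ℤ * τ * ∑∑ (λ s′ t′ → step s t s′ t′ * walk step i s′ t′) ∎
    where
    open ≡-Reasoning
    σ τ : ℤ
    σ = -1ℤ ^ (s ℕ.+ t)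
    τ = -1ℤ ^ (i ℕ.+ (m ℕ.+ n))
    r₁ : ∀ σ a w → σ * (a * w) ≡ a * σ * w
    r₁ = solve-∀
    r₂ : ∀ a u w → -1ℤ * (a * u) * w ≡ -1ℤ * (a * (w * u))
    r₂ = solve-∀
    r₃ : ∀ a τ w → -1ℤ * (a * (τ * w)) ≡ -1ℤ * τ * (a * w)
    r₃ = solve-∀

-- The signed sum over Γ

nCk*k!*[n∸k]!≡n! : ∀ {n k} → k ≤ n → (n C k) ℕ.* (k ! ℕ.* (n ∸ k) !) ≡ n !
nCk*k!*[n∸k]!≡n! {n} {k} k≤n =
  trans (cong (ℕ._* (k ! ℕ.* (n ∸ k) !)) (nCk≡n!/k![n-k]! k≤n)) (m/n*n≡m (k![n∸k]!∣n! k≤n))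
  where instance
  _ : NonZero (k ! ℕ.* (n ∸ k) !)
  _ = k ℕ.!* (n ∸ k) !≢0

factorials : List ℕ → ℕ
factorials cs = product (map _! cs)

factorials≢0 : ∀ cs → NonZero (factorials cs)
factorials≢0 []       = _
factorials≢0 (c ∷ cs) = ℕ.m*n≢0 (c !) (factorials cs) {{c ℕ.!≢0}} {{factorials≢0 cs}}

-- This makes the natural-number division in `multinomial` exact; one binomial coefficient is split
-- off at a time.
factorials-∣ : ∀ cs → factorials cs divides sum cs !
factorials-∣ []       = div-refl
factorials-∣ (c ∷ cs) = div-trans (div-monoʳ (c !) (factorials-∣ cs))
  (subst (λ k → c ! ℕ.* k ! divides (c ℕ.+ sum cs) !) (ℕ.m+n∸m≡n c (sum cs)) (k![n∸k]!∣n! (ℕ.m≤m+n c (sum cs))))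

multinomial-≡ : ∀ {p} cs → sum cs ≡ p → multinomial p cs ℕ.* factorials cs ≡ p !
multinomial-≡ {p} cs refl = trans
  (cong (λ z → (if z then p ! ℕ./ factorials cs else 0) ℕ.* factorials cs) (dec-true (sum cs ≟ p) refl))
  (m/n*n≡m (factorials-∣ cs))
  where instance
  _ : NonZero (factorials cs)
  _ = factorials≢0 cs

multinomial-≢ : ∀ {p} cs → sum cs ≢ p → multinomial p cs ≡ 0
multinomial-≢ {p} cs neq =
  cong (λ z → if z then p ! ℕ./ factorials cs else 0) (dec-false (sum cs ≟ p) neq)
  where instance
  _ : NonZero (factorials cs)
  _ = factorials≢0 cs

-- If c ≤ p and the entries add up to p, both sides become p ! after multiplication by the nonzero
-- `factorials (c ∷ cs)`; in all other cases both are 0. It peels the first increment off a chain,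
-- leaving the binomial coefficient that `β` contains.
multinomial-∷ : ∀ p c cs → multinomial p (c ∷ cs) ≡ (p C c) ℕ.* multinomial (p ∸ c) cs
multinomial-∷ p c cs with c ≤? p | sum cs ≟ p ∸ c
... | no c≰p | _ = trans (multinomial-≢ (c ∷ cs) λ { refl → c≰p (ℕ.m≤m+n c (sum cs)) })
  (sym (cong (ℕ._* multinomial (p ∸ c) cs) (k>n⇒nCk≡0 (ℕ.≰⇒> c≰p))))
... | yes c≤p | no neq = trans (multinomial-≢ (c ∷ cs) λ { refl → neq (sym (ℕ.m+n∸m≡n c (sum cs))) })
  (sym (trans (cong ((p C c) ℕ.*_) (multinomial-≢ cs neq)) (ℕ.*-zeroʳ (p C c))))
... | yes c≤p | yes eq = ℕ.*-cancelʳ-≡ _ _ (factorials (c ∷ cs)) {{factorials≢0 (c ∷ cs)}} (begin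
  multinomial p (c ∷ cs) ℕ.* factorials (c ∷ cs)
    ≡⟨ multinomial-≡ (c ∷ cs) (trans (cong (c ℕ.+_) eq) (ℕ.m+[n∸m]≡n c≤p)) ⟩
  p !
    ≡⟨ nCk*k!*[n∸k]!≡n! c≤p ⟨
  (p C c) ℕ.* (c ! ℕ.* (p ∸ c) !)
    ≡⟨ cong (λ z → (p C c) ℕ.* (c ! ℕ.* z)) (multinomial-≡ cs eq) ⟨
  (p C c) ℕ.* (c ! ℕ.* (multinomial (p ∸ c) cs ℕ.* factorials cs))
    ≡⟨ rearrange (p C c) (c !) (multinomial (p ∸ c) cs) (factorials cs) ⟩
  (p C c) ℕ.* multinomial (p ∸ c) cs ℕ.* factorials (c ∷ cs) ∎)
  where
  open ≡-Reasoning
  rearrange : ∀ a b c d → a ℕ.* (b ℕ.* (c ℕ.* d)) ≡ a ℕ.* c ℕ.* (b ℕ.* d)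
  rearrange = solveℕ-∀

product-filter : ∀ {A : Set} {p} {P : Pred A p} (P? : Decidable P) (f : A → ℕ) xs →
  product (map f (filter P? xs)) ≡ product (map (λ x → if does (P? x) then f x else 1) xs)
product-filter P? f []       = refl
product-filter P? f (x ∷ xs) with P? x
... | yes _ = cong (f x ℕ.*_) (product-filter P? f xs)
... | no _  = trans (product-filter P? f xs) (sym (ℕ.+-identityʳ _))

pos-^ : ∀ x k → + (x ℕ.^ k) ≡ (+ x) ^ k
pos-^ x zero    = refl
pos-^ x (suc k) = trans (ℤ.pos-* x (x ℕ.^ k)) (cong (+ x *_) (pos-^ x k))

pos-*₃ : ∀ p q r → + (p ℕ.* q ℕ.* r) ≡ + p * + q * + r
pos-*₃ p q r = trans (ℤ.pos-* (p ℕ.* q) r) (cong (_* + r) (ℤ.pos-* p q))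

-- Elements of Γ as walks on pairs of sizes

module Chains (m n : ℕ) where

  open Walks m n

  -- The contribution of a single path to `walk step i`. Here and in the definitions below the start
  -- (a , c) replaces (0 , 0), so that the tail of a path is an object of the same kind.
  pathWeight : ∀ {i} → ℕ → ℕ → Vec ℕ i → Vec ℕ i → ℤ
  pathWeight a c []      []      = end a c
  pathWeight a c (x ∷ s) (y ∷ t) = step a c x y * pathWeight x y s t

  ∑-pathWeight : ∀ i a c →
    ∑ (tuples (m ℕ.+ n) i) (λ s → ∑ (tuples (m ℕ.+ n) i) (λ t → pathWeight a c s t)) ≡ walk step i a c
  ∑-pathWeight zero    a c = trans (∑-[-] [] _) (∑-[-] [] _)
  ∑-pathWeight (suc i) a c = begin
    ∑ (tuples (m ℕ.+ n) (suc i)) (λ s → ∑ (tuples (m ℕ.+ n) (suc i)) (pathWeight a c s))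
      ≡⟨ ∑-cartesianProductWith _∷_ (upTo b) τ _ ⟩
    ∑ (upTo b) (λ x → ∑ τ (λ s → ∑ (tuples (m ℕ.+ n) (suc i)) (pathWeight a c (x ∷ s))))
      ≡⟨ ∑-cong (upTo b) (λ x → trans
           (∑-cong τ λ s → ∑-cartesianProductWith _∷_ (upTo b) τ (pathWeight a c (x ∷ s)))
           (∑-swap τ (upTo b) _)) ⟩
    ∑∑ (λ x y → ∑ τ (λ s → ∑ τ (λ t → step a c x y * pathWeight x y s t)))
      ≡⟨ ∑∑-cong (λ x y → trans
           (trans (∑-cong τ λ s → ∑-*ˡ τ (step a c x y) (pathWeight x y s)) (∑-*ˡ τ (step a c x y) _))
           (cong (step a c x y *_) (∑-pathWeight i x y))) ⟩
    ∑∑ (λ x y → step a c x y * walk step i x y) ∎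
    where
    open ≡-Reasoning
    τ : List (Vec ℕ i)
    τ = tuples (m ℕ.+ n) i

  incrementsFrom : ∀ {i} → ℕ → Vec ℕ i → List ℕ
  incrementsFrom a []      = []
  incrementsFrom a (x ∷ s) = (x ∸ a) ∷ incrementsFrom x s

  tabulate-increments : ∀ {i} a (s : Vec ℕ i) →
    List.tabulate (λ j → lookup s j ∸ lookup (a ∷ s) (inject₁ j)) ≡ incrementsFrom a s
  tabulate-increments a []      = refl
  tabulate-increments a (x ∷ s) = cong (x ∸ a ∷_) (tabulate-increments x s)

  μFrom : ∀ {i} → ℕ → ℕ → Vec ℕ i → Vec ℕ i → ℕ
  μFrom a c []      []      = 1
  μFrom a c (x ∷ s) (y ∷ t) = dˡ x y ℕ.^ (x ∸ a) ℕ.* dʳ x y ℕ.^ (y ∸ c) ℕ.* μFrom x y s t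

  tabulate-μ : ∀ {i} a c (s t : Vec ℕ i) →
    product (List.tabulate λ j → if does ((lookup s j <? m) ×-dec (lookup t j <? n))
      then (n ∸ lookup t j) ℕ.^ (lookup s j ∸ lookup (a ∷ s) (inject₁ j)) ℕ.*
           (m ∸ lookup s j) ℕ.^ (lookup t j ∸ lookup (c ∷ t) (inject₁ j))
      else 1) ≡ μFrom a c s t
  tabulate-μ a c []      []      = refl
  tabulate-μ a c (x ∷ s) (y ∷ t) = cong₂ ℕ._*_ (head (does ((x <? m) ×-dec (y <? n)))) (tabulate-μ x y s t)
    where
    head : ∀ d → (if d then (n ∸ y) ℕ.^ (x ∸ a) ℕ.* (m ∸ x) ℕ.^ (y ∸ c) else 1) ≡
                 (if d then n ∸ y else 1) ℕ.^ (x ∸ a) ℕ.* (if d then m ∸ x else 1) ℕ.^ (y ∸ c)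
    head true  = refl
    -- Outside `𝔗` both `dˡ` and `dʳ` are 1, so their powers reproduce the factor that μ omits.
    head false = sym (cong₂ ℕ._*_ (ℕ.^-zeroˡ (x ∸ a)) (ℕ.^-zeroˡ (y ∸ c)))

  increments-≡ : ∀ {i} (s : Vec ℕ i) → increments s ≡ incrementsFrom 0 s
  increments-≡ s = trans (map-tabulate id (increment s)) (tabulate-increments 0 s)

  μ-≡ : ∀ {i} (s t : Vec ℕ i) → μ m n s t ≡ μFrom 0 0 s t
  μ-≡ {i} s t = trans (product-filter (𝔗? m n s t) (factor m n s t) (allFin i))
    (trans (cong product (map-tabulate id (λ j → if does (𝔗? m n s t j) then factor m n s t j else 1))) (tabulate-μ 0 0 s t))

  -- A recursive form of `Γ`, which quantifies over indices; it follows the recursion of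
  -- `pathWeight`.
  Chain : ∀ {i} → ℕ → ℕ → Vec ℕ i → Vec ℕ i → Set
  Chain a c []      []      = a ℕ.+ c ≡ m ℕ.+ n
  Chain a c (x ∷ s) (y ∷ t) = a ≤ x × c ≤ y × a ℕ.+ c < x ℕ.+ y × Chain x y s t

  chain? : ∀ {i} a c (s t : Vec ℕ i) → Dec (Chain a c s t)
  chain? a c []      []      = a ℕ.+ c ≟ m ℕ.+ n
  chain? a c (x ∷ s) (y ∷ t) = a ≤? x ×-dec c ≤? y ×-dec a ℕ.+ c <? x ℕ.+ y ×-dec chain? x y s t

  toChain : ∀ {i} a c (s t : Vec ℕ i) →
    (∀ j → lookup (a ∷ s) (inject₁ j) ≤ lookup s j) →
    (∀ j → lookup (c ∷ t) (inject₁ j) ≤ lookup t j) →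
    lookup (a ∷ s) (fromℕ i) ℕ.+ lookup (c ∷ t) (fromℕ i) ≡ m ℕ.+ n →
    (∀ j → lookup (a ∷ s) (inject₁ j) ℕ.+ lookup (c ∷ t) (inject₁ j) < lookup s j ℕ.+ lookup t j) →
    Chain a c s t
  toChain a c []      []      p q e r = e
  toChain a c (x ∷ s) (y ∷ t) p q e r =
    p zero , q zero , r zero , toChain x y s t (p ∘ suc) (q ∘ suc) e (r ∘ suc)

  chain-≤ˡ : ∀ {i} a c (s t : Vec ℕ i) → Chain a c s t → ∀ j → lookup (a ∷ s) (inject₁ j) ≤ lookup s j
  chain-≤ˡ a c (x ∷ s) (y ∷ t) (p , _)         zero    = p
  chain-≤ˡ a c (x ∷ s) (y ∷ t) (_ , _ , _ , h) (suc j) = chain-≤ˡ x y s t h j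

  chain-≤ʳ : ∀ {i} a c (s t : Vec ℕ i) → Chain a c s t → ∀ j → lookup (c ∷ t) (inject₁ j) ≤ lookup t j
  chain-≤ʳ a c (x ∷ s) (y ∷ t) (_ , q , _)     zero    = q
  chain-≤ʳ a c (x ∷ s) (y ∷ t) (_ , _ , _ , h) (suc j) = chain-≤ʳ x y s t h j

  chain-< : ∀ {i} a c (s t : Vec ℕ i) → Chain a c s t → ∀ j →
    lookup (a ∷ s) (inject₁ j) ℕ.+ lookup (c ∷ t) (inject₁ j) < lookup s j ℕ.+ lookup t j
  chain-< a c (x ∷ s) (y ∷ t) (_ , _ , r , _) zero    = r
  chain-< a c (x ∷ s) (y ∷ t) (_ , _ , _ , h) (suc j) = chain-< x y s t h j

  chain-total : ∀ {i} a c (s t : Vec ℕ i) → Chain a c s t →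
    lookup (a ∷ s) (fromℕ i) ℕ.+ lookup (c ∷ t) (fromℕ i) ≡ m ℕ.+ n
  chain-total a c []      []      h               = h
  chain-total a c (x ∷ s) (y ∷ t) (_ , _ , _ , h) = chain-total x y s t h

  𝟙-Γ : ∀ {i} (s t : Vec ℕ i) → 𝟙 (Γ? m n s t) ≡ 𝟙 (chain? 0 0 s t)
  𝟙-Γ s t = 𝟙-cong (Γ? m n s t) (chain? 0 0 s t)
    (λ γ → let open Γ γ in toChain 0 0 s t s-monotone t-monotone total increasing)
    (λ h → mkΓ (chain-≤ˡ 0 0 s t h) (chain-≤ʳ 0 0 s t h) (chain-total 0 0 s t h) (chain-< 0 0 s t h))

  weightFrom : ∀ {i} → ℕ → ℕ → Vec ℕ i → Vec ℕ i → ℕ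
  weightFrom a c s t = multinomial (m ∸ a) (incrementsFrom a s) ℕ.* multinomial (n ∸ c) (incrementsFrom c t) ℕ.* μFrom a c s t

  multinomial-[] : ∀ {a} → a ≡ 0 → multinomial a [] ≡ 1
  multinomial-[] refl = refl

  -- The bounds a ≤ m and c ≤ n are the invariant: under them a + c = m + n forces the end (m , n),
  -- although `Γ` prescribes only the sum. A chain that leaves the rectangle has weight 0.
  weightFrom-path : ∀ {i} a c (s t : Vec ℕ i) → a ≤ m → c ≤ n →
    𝟙 (chain? a c s t) * + weightFrom a c s t ≡ pathWeight a c s t
  weightFrom-path a c [] [] a≤m c≤n = go (a ≟ m) (c ≟ n)
    where
    go : Dec (a ≡ m) → Dec (c ≡ n) → 𝟙 (a ℕ.+ c ≟ m ℕ.+ n) * + weightFrom a c [] [] ≡ end a c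
    go (yes a≡m) (yes c≡n) = trans
      (cong₂ (λ p q → p * + q) (𝟙-true (a ℕ.+ c ≟ m ℕ.+ n) (cong₂ ℕ._+_ a≡m c≡n))
        (cong₂ (λ p q → p ℕ.* q ℕ.* 1) (multinomial-[] (ℕ.m≤n⇒m∸n≡0 (ℕ.≤-reflexive (sym a≡m))))
          (multinomial-[] (ℕ.m≤n⇒m∸n≡0 (ℕ.≤-reflexive (sym c≡n))))))
      (sym (𝟙-true ((a ≟ m) ×-dec (c ≟ n)) (a≡m , c≡n)))
    go (no a≢m) _ = trans
      (cong (_* + weightFrom a c [] []) (𝟙-false (a ℕ.+ c ≟ m ℕ.+ n) λ eq → ℕ.<-irrefl eq (ℕ.+-mono-<-≤ (ℕ.≤∧≢⇒< a≤m a≢m) c≤n)))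
      (sym (𝟙-false ((a ≟ m) ×-dec (c ≟ n)) (a≢m ∘ proj₁)))
    go _ (no c≢n) = trans
      (cong (_* + weightFrom a c [] []) (𝟙-false (a ℕ.+ c ≟ m ℕ.+ n) λ eq → ℕ.<-irrefl eq (ℕ.+-mono-≤-< a≤m (ℕ.≤∧≢⇒< c≤n c≢n))))
      (sym (𝟙-false ((a ≟ m) ×-dec (c ≟ n)) (c≢n ∘ proj₂)))
  weightFrom-path a c (x ∷ s) (y ∷ t) a≤m c≤n = begin
    𝟙 (chain? a c (x ∷ s) (y ∷ t)) * + weightFrom a c (x ∷ s) (y ∷ t)
      ≡⟨ cong₂ _*_ 𝟙-chain weight-split ⟩
    i₁ * (i₂ * (i₃ * i₄)) * (C₁ * M₁ * (C₂ * M₂) * (D₁ * D₂ * U))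
      ≡⟨ r₁ i₁ i₂ i₃ i₄ C₁ M₁ C₂ M₂ D₁ D₂ U ⟩
    k * (i₄ * (M₁ * M₂ * U))
      ≡⟨ main (a ≤? x) (c ≤? y) (x ≤? m) (y ≤? n) ⟩
    i₃ * (i₁ * (C₁ * D₁) * (i₂ * (C₂ * D₂))) * pathWeight x y s t
      ≡⟨ cong₂ (λ p q → i₃ * (p * q) * pathWeight x y s t) (β-def m a x (+ dˡ x y)) (β-def n c y (+ dʳ x y)) ⟨
    step a c x y * pathWeight x y s t ∎
    where
    open ≡-Reasoning
    i₁ i₂ i₃ i₄ C₁ C₂ M₁ M₂ D₁ D₂ U k : ℤ
    i₁ = 𝟙 (a ≤? x)
    i₂ = 𝟙 (c ≤? y)
    i₃ = 𝟙 (a ℕ.+ c <? x ℕ.+ y)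
    i₄ = 𝟙 (chain? x y s t)
    C₁ = + ((m ∸ a) C (x ∸ a))
    C₂ = + ((n ∸ c) C (y ∸ c))
    M₁ = + multinomial (m ∸ a ∸ (x ∸ a)) (incrementsFrom x s)
    M₂ = + multinomial (n ∸ c ∸ (y ∸ c)) (incrementsFrom y t)
    D₁ = (+ dˡ x y) ^ (x ∸ a)
    D₂ = (+ dʳ x y) ^ (y ∸ c)
    U  = + μFrom x y s t
    k  = i₃ * (i₁ * (C₁ * D₁) * (i₂ * (C₂ * D₂)))

    𝟙-chain : 𝟙 (chain? a c (x ∷ s) (y ∷ t)) ≡ i₁ * (i₂ * (i₃ * i₄))
    𝟙-chain = trans (𝟙-× (a ≤? x) _) (cong (i₁ *_) (trans (𝟙-× (c ≤? y) _)
      (cong (i₂ *_) (𝟙-× (a ℕ.+ c <? x ℕ.+ y) (chain? x y s t)))))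

    pos-multinomial : ∀ p e cs → + multinomial p (e ∷ cs) ≡ + (p C e) * + multinomial (p ∸ e) cs
    pos-multinomial p e cs = trans (cong +_ (multinomial-∷ p e cs)) (ℤ.pos-* (p C e) _)

    weight-split : + weightFrom a c (x ∷ s) (y ∷ t) ≡ C₁ * M₁ * (C₂ * M₂) * (D₁ * D₂ * U)
    weight-split = trans
      (pos-*₃ (multinomial (m ∸ a) (incrementsFrom a (x ∷ s))) (multinomial (n ∸ c) (incrementsFrom c (y ∷ t))) (μFrom a c (x ∷ s) (y ∷ t)))
      (cong₂ _*_
        (cong₂ _*_ (pos-multinomial (m ∸ a) (x ∸ a) (incrementsFrom x s)) (pos-multinomial (n ∸ c) (y ∸ c) (incrementsFrom y t)))
        (trans (pos-*₃ (dˡ x y ℕ.^ (x ∸ a)) (dʳ x y ℕ.^ (y ∸ c)) (μFrom x y s t))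
          (cong₂ (λ p q → p * q * U) (pos-^ (dˡ x y) (x ∸ a)) (pos-^ (dʳ x y) (y ∸ c)))))

    vanish : k ≡ 0ℤ → k * (i₄ * (M₁ * M₂ * U)) ≡ k * pathWeight x y s t
    vanish eq = trans (cong (_* (i₄ * (M₁ * M₂ * U))) eq) (sym (cong (_* pathWeight x y s t) eq))

    ∸-∸ : ∀ {p a x} → a ≤ x → p ∸ a ∸ (x ∸ a) ≡ p ∸ x
    ∸-∸ {p} {a} {x} a≤x = trans (ℕ.∸-+-assoc p a (x ∸ a)) (cong (p ∸_) (ℕ.m+[n∸m]≡n a≤x))

    C-vanish : ∀ {p a x} → a ≤ p → ¬ x ≤ p → + ((p ∸ a) C (x ∸ a)) ≡ 0ℤ
    C-vanish a≤p x≰p = cong +_ (k>n⇒nCk≡0 (ℕ.∸-monoˡ-< (ℕ.≰⇒> x≰p) a≤p))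

    main : Dec (a ≤ x) → Dec (c ≤ y) → Dec (x ≤ m) → Dec (y ≤ n) →
           k * (i₄ * (M₁ * M₂ * U)) ≡ k * pathWeight x y s t
    main (no a≰x) _ _ _ = vanish (trans (cong (λ z → i₃ * (z * (C₁ * D₁) * (i₂ * (C₂ * D₂)))) (𝟙-false (a ≤? x) a≰x))
      (z₁ i₃ (C₁ * D₁) (i₂ * (C₂ * D₂))))
      where
      z₁ : ∀ a b c → a * (0ℤ * b * c) ≡ 0ℤ
      z₁ = solve-∀
    main _ (no c≰y) _ _ = vanish (trans (cong (λ z → i₃ * (i₁ * (C₁ * D₁) * (z * (C₂ * D₂)))) (𝟙-false (c ≤? y) c≰y))
      (z₂ i₃ (i₁ * (C₁ * D₁)) (C₂ * D₂)))
      where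
      z₂ : ∀ a b c → a * (b * (0ℤ * c)) ≡ 0ℤ
      z₂ = solve-∀
    main _ _ (no x≰m) _ = vanish (trans (cong (λ z → i₃ * (i₁ * (z * D₁) * (i₂ * (C₂ * D₂)))) (C-vanish a≤m x≰m))
      (z₃ i₃ i₁ D₁ (i₂ * (C₂ * D₂))))
      where
      z₃ : ∀ a b c d → a * (b * (0ℤ * c) * d) ≡ 0ℤ
      z₃ = solve-∀
    main _ _ _ (no y≰n) = vanish (trans (cong (λ z → i₃ * (i₁ * (C₁ * D₁) * (i₂ * (z * D₂)))) (C-vanish c≤n y≰n))
      (z₄ i₃ (i₁ * (C₁ * D₁)) i₂ D₂))
      where
      z₄ : ∀ a b c d → a * (b * (c * (0ℤ * d))) ≡ 0ℤ
      z₄ = solve-∀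
    main (yes a≤x) (yes c≤y) (yes x≤m) (yes y≤n) = cong (k *_) (trans
      (cong (i₄ *_) (trans
        (cong₂ (λ p q → + multinomial p (incrementsFrom x s) * + multinomial q (incrementsFrom y t) * U) (∸-∸ {m} a≤x) (∸-∸ {n} c≤y))
        (sym (pos-*₃ (multinomial (m ∸ x) (incrementsFrom x s)) (multinomial (n ∸ y) (incrementsFrom y t)) (μFrom x y s t)))))
      (weightFrom-path x y s t x≤m y≤n))

    r₁ : ∀ i₁ i₂ i₃ i₄ C₁ M₁ C₂ M₂ D₁ D₂ U →
      i₁ * (i₂ * (i₃ * i₄)) * (C₁ * M₁ * (C₂ * M₂) * (D₁ * D₂ * U)) ≡
      i₃ * (i₁ * (C₁ * D₁) * (i₂ * (C₂ * D₂))) * (i₄ * (M₁ * M₂ * U))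
    r₁ = solve-∀

  ∑-weight : ∀ i → + sum (map (weight m n) (Γ-list m n i)) ≡ walk step i 0 0
  ∑-weight i = begin
    + sum (map (weight m n) (Γ-list m n i))
      ≡⟨ ∑-pos (Γ-list m n i) (weight m n) ⟩
    ∑ (Γ-list m n i) (λ st → + weight m n st)
      ≡⟨ ∑-filter (uncurry (Γ? m n)) (cartesianProduct τ τ) _ ⟩
    ∑ (cartesianProduct τ τ) (λ (s , t) → 𝟙 (Γ? m n s t) * + weight m n (s , t))
      ≡⟨ ∑-cartesianProductWith _,_ τ τ _ ⟩
    ∑ τ (λ s → ∑ τ (λ t → 𝟙 (Γ? m n s t) * + weight m n (s , t)))
      ≡⟨ ∑-cong τ (λ s → ∑-cong τ λ t → trans
           (cong₂ (λ p q → p * + q) (𝟙-Γ s t) (cong₂ ℕ._*_ (cong₂ ℕ._*_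
             (cong (multinomial m) (increments-≡ s)) (cong (multinomial n) (increments-≡ t))) (μ-≡ s t)))
           (weightFrom-path 0 0 s t z≤n z≤n)) ⟩
    ∑ τ (λ s → ∑ τ (λ t → pathWeight 0 0 s t))
      ≡⟨ ∑-pathWeight i 0 0 ⟩
    walk step i 0 0 ∎
    where
    open ≡-Reasoning
    τ : List (Vec ℕ i)
    τ = tuples (m ℕ.+ n) i

  -1^2k≡1 : ∀ k → -1ℤ ^ (k ℕ.+ k) ≡ 1ℤ
  -1^2k≡1 zero    = refl
  -1^2k≡1 (suc k) = trans (cong (λ e → -1ℤ * -1ℤ ^ e) (ℕ.+-suc k k)) (trans (double (-1ℤ ^ (k ℕ.+ k))) (-1^2k≡1 k))
    where
    double : ∀ x → -1ℤ * (-1ℤ * x) ≡ x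
    double = solve-∀

  summand-walk : ∀ {i} → i ≤ m ℕ.+ n → summand m n i ≡ walk signedStep i 0 0
  summand-walk {i} i≤N = begin
    -1ℤ ^ (N ∸ i) * + sum (map (weight m n) (Γ-list m n i))
      ≡⟨ cong₂ _*_ sign (∑-weight i) ⟩
    -1ℤ ^ (i ℕ.+ N) * walk step i 0 0
      ≡⟨ walk-sign i 0 0 ⟨
    walk signedStep i 0 0 * 1ℤ
      ≡⟨ ℤ.*-identityʳ (walk signedStep i 0 0) ⟩
    walk signedStep i 0 0 ∎
    where
    open ≡-Reasoning
    N : ℕ
    N = m ℕ.+ n
    -- For i ≤ N the two exponents differ by 2i.
    sign : -1ℤ ^ (N ∸ i) ≡ -1ℤ ^ (i ℕ.+ N)
    sign = begin
      -1ℤ ^ (N ∸ i)                        ≡⟨ ℤ.*-identityʳ (-1ℤ ^ (N ∸ i)) ⟨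
      -1ℤ ^ (N ∸ i) * 1ℤ                   ≡⟨ cong (-1ℤ ^ (N ∸ i) *_) (-1^2k≡1 i) ⟨
      -1ℤ ^ (N ∸ i) * -1ℤ ^ (i ℕ.+ i)      ≡⟨ ℤ.^-distribˡ-+-* -1ℤ (N ∸ i) (i ℕ.+ i) ⟨
      -1ℤ ^ (N ∸ i ℕ.+ (i ℕ.+ i))          ≡⟨ cong (-1ℤ ^_) (trans (sym (ℕ.+-assoc (N ∸ i) i i))
                                                (trans (cong (ℕ._+ i) (ℕ.m∸n+n≡m i≤N)) (ℕ.+-comm N i))) ⟩
      -1ℤ ^ (i ℕ.+ N) ∎

  -- The potential has one more term, for walks of length 0; it is `end 0 0`, which is 0 because m ≥
  -- 1.
  signedSum-potential : m ≥ 1 → signedSum m n ≡ potential 0 0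
  signedSum-potential m≥1 = begin
    signedSum m n
      ≡⟨ ∑-sumℤ (map suc (upTo (m ℕ.+ n))) (summand m n) ⟩
    ∑ (map suc (upTo (m ℕ.+ n))) (summand m n)
      ≡⟨ ∑-map suc (upTo (m ℕ.+ n)) (summand m n) ⟩
    ∑ (upTo (m ℕ.+ n)) (λ i → summand m n (suc i))
      ≡⟨ ∑-cong-∈ (upTo (m ℕ.+ n)) (λ i∈ → summand-walk (∈-upTo⁻ i∈)) ⟩
    ∑ (upTo (m ℕ.+ n)) (λ i → walk signedStep (suc i) 0 0)
      ≡⟨ ℤ.+-identityˡ _ ⟨
    0ℤ + ∑ (upTo (m ℕ.+ n)) (λ i → walk signedStep (suc i) 0 0)
      ≡⟨ cong (λ z → z + ∑ (upTo (m ℕ.+ n)) (λ i → walk signedStep (suc i) 0 0))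
           (𝟙-false ((0 ≟ m) ×-dec (0 ≟ n)) λ (eq , _) → ℕ.<-irrefl eq m≥1) ⟨
    end 0 0 + ∑ (upTo (m ℕ.+ n)) (λ i → walk signedStep (suc i) 0 0)
      ≡⟨ ∑-upTo-suc (m ℕ.+ n) (λ i → walk signedStep i 0 0) ⟨
    potential 0 0 ∎
    where open ≡-Reasoning

-- Complete bipartite graphs

take-++ : ∀ {A : Set} {m n} (u : Vec A m) (v : Vec A n) → take m (u ++ v) ≡ u
take-++ []      v = refl
take-++ (x ∷ u) v = cong (x ∷_) (take-++ u v)

drop-++ : ∀ {A : Set} {m n} (u : Vec A m) (v : Vec A n) → drop m (u ++ v) ≡ v
drop-++ []      v = refl
drop-++ (x ∷ u) v = drop-++ u v

take-replicate : ∀ {A : Set} m n (x : A) → take m (replicate (m ℕ.+ n) x) ≡ replicate m x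
take-replicate zero    n x = refl
take-replicate (suc m) n x = cong (x ∷_) (take-replicate m n x)

drop-replicate : ∀ {A : Set} m n (x : A) → drop m (replicate (m ℕ.+ n) x) ≡ replicate n x
drop-replicate zero    n x = refl
drop-replicate (suc m) n x = drop-replicate m n x

∈-take⁺ : ∀ m {n} {A : Subset (m ℕ.+ n)} {i : Fin m} → i ↑ˡ n ∈ A → i ∈ take m A
∈-take⁺ (suc m) {A = _ ∷ _} {zero}  here       = here
∈-take⁺ (suc m) {A = _ ∷ _} {suc i} (there i∈) = there (∈-take⁺ m i∈)

∈-take⁻ : ∀ m {n} {A : Subset (m ℕ.+ n)} {i : Fin m} → i ∈ take m A → i ↑ˡ n ∈ A
∈-take⁻ (suc m) {A = _ ∷ _} {zero}  here       = here
∈-take⁻ (suc m) {A = _ ∷ _} {suc i} (there i∈) = there (∈-take⁻ m i∈)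

∈-drop⁺ : ∀ m {n} {A : Subset (m ℕ.+ n)} {j : Fin n} → m ↑ʳ j ∈ A → j ∈ drop m A
∈-drop⁺ zero            j∈         = j∈
∈-drop⁺ (suc m) {A = _ ∷ _} (there j∈) = ∈-drop⁺ m j∈

∈-drop⁻ : ∀ m {n} {A : Subset (m ℕ.+ n)} {j : Fin n} → j ∈ drop m A → m ↑ʳ j ∈ A
∈-drop⁻ zero            j∈ = j∈
∈-drop⁻ (suc m) {A = _ ∷ _} j∈ = there (∈-drop⁻ m j∈)

↑-case : ∀ {ℓ} m {n} (P : Fin (m ℕ.+ n) → Set ℓ) → (∀ i → P (i ↑ˡ n)) → (∀ j → P (m ↑ʳ j)) → ∀ i → P i
↑-case zero    P f g i       = g i
↑-case (suc m) P f g zero    = f zero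
↑-case (suc m) P f g (suc i) = ↑-case m (P ∘ suc) (f ∘ suc) g i

∣take∣+∣drop∣ : ∀ m {n} (A : Subset (m ℕ.+ n)) → ∣ take m A ∣ ℕ.+ ∣ drop m A ∣ ≡ ∣ A ∣
∣take∣+∣drop∣ zero    A             = refl
∣take∣+∣drop∣ (suc m) (outside ∷ A) = ∣take∣+∣drop∣ m A
∣take∣+∣drop∣ (suc m) (inside ∷ A)  = cong suc (∣take∣+∣drop∣ m A)

∑-subsets-++ : ∀ m {n} (f : Subset (m ℕ.+ n) → ℤ) →
  ∑ (subsets (m ℕ.+ n)) f ≡ ∑ (subsets m) (λ S → ∑ (subsets n) (λ T → f (S ++ T)))
∑-subsets-++ zero    f = sym (∑-[-] [] _)
∑-subsets-++ (suc m) f = trans (∑-subsets-suc f) (trans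
  (cong₂ _+_ (∑-subsets-++ m (f ∘ (outside ∷_))) (∑-subsets-++ m (f ∘ (inside ∷_))))
  (sym (∑-subsets-suc (λ S → ∑ (subsets _) (λ T → f (S ++ T))))))

links-++ : ∀ m {n} (A A′ : Subset (m ℕ.+ n)) (x : Fin (m ℕ.+ n) → ℤ) →
  links A A′ x ≡ links (take m A) (take m A′) (λ i → x (i ↑ˡ n)) * links (drop m A) (drop m A′) (λ j → x (m ↑ʳ j))
links-++ zero    A       A′        x = sym (ℤ.*-identityˡ (links A A′ x))
links-++ (suc m) (c ∷ A) (c′ ∷ A′) x = trans (cong (link c c′ (x zero) *_) (links-++ m A A′ (x ∘ suc)))
  (sym (ℤ.*-assoc (link c c′ (x zero)) (links (take m A) (take m A′) (λ i → x (suc i ↑ˡ _))) _))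

-- It has the exact shape of the sum in `degree`, so that `degreeOf` below agrees with `degree` by
-- definition.
subsetSum : ∀ {k} → Subset k → (Fin k → ℕ) → ℕ
subsetSum {k} X f = sum (map f (filter (_∈? X) (allFin k)))

subsetSum-∷ : ∀ {k} x (X : Subset k) (f : Fin (suc k) → ℕ) →
  subsetSum (x ∷ X) f ≡ (if x then f zero else 0) ℕ.+ subsetSum X (f ∘ suc)
subsetSum-∷ {k} x X f = trans (head x) (cong ((if x then f zero else 0) ℕ.+_)
  (trans (cong (λ js → sum (map f (filter (_∈? (x ∷ X)) js))) (sym (map-tabulate id suc))) (tail (allFin k))))
  where
  head : ∀ x → sum (map f (filter (_∈? (x ∷ X)) (allFin (suc k)))) ≡
    (if x then f zero else 0) ℕ.+ sum (map f (filter (_∈? (x ∷ X)) (List.tabulate suc)))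
  head inside  = refl
  head outside = refl
  tail : ∀ js → sum (map f (filter (_∈? (x ∷ X)) (map suc js))) ≡ sum (map (f ∘ suc) (filter (_∈? X) js))
  tail []       = refl
  tail (j ∷ js) with j ∈? X
  ... | yes _ = cong (f (suc j) ℕ.+_) (tail js)
  ... | no _  = tail js

subsetSum-const : ∀ {k} (X : Subset k) (f : Fin k → ℕ) {c} → (∀ j → f j ≡ c) → subsetSum X f ≡ ∣ X ∣ ℕ.* c
subsetSum-const []            f eq = refl
subsetSum-const (outside ∷ X) f eq = trans (subsetSum-∷ outside X f) (subsetSum-const X (f ∘ suc) (eq ∘ suc))
subsetSum-const (inside ∷ X)  f eq = trans (subsetSum-∷ inside X f) (cong₂ ℕ._+_ (eq zero) (subsetSum-const X (f ∘ suc) (eq ∘ suc)))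

subsetSum-split : ∀ m {n} (X : Subset (m ℕ.+ n)) (f : Fin (m ℕ.+ n) → ℕ) {c c′} →
  (∀ i → f (i ↑ˡ n) ≡ c) → (∀ j → f (m ↑ʳ j) ≡ c′) →
  subsetSum X f ≡ ∣ take m X ∣ ℕ.* c ℕ.+ ∣ drop m X ∣ ℕ.* c′
subsetSum-split zero    X             f eq eq′ = subsetSum-const X f eq′
subsetSum-split (suc m) (outside ∷ X) f eq eq′ =
  trans (subsetSum-∷ outside X f) (subsetSum-split m X (f ∘ suc) (eq ∘ suc) eq′)
subsetSum-split (suc m) (inside ∷ X)  f {c} eq eq′ =
  trans (subsetSum-∷ inside X f) (trans (cong₂ ℕ._+_ (eq zero) (subsetSum-split m X (f ∘ suc) (eq ∘ suc) eq′))
    (sym (ℕ.+-assoc c _ _)))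

-- Thresholds, stable counts and degrees for the bipartite graph

module Bipartite (m n : ℕ) where

  open Walks m n
  open Chains m n

  sizeˡ sizeʳ : Subset (m ℕ.+ n) → ℕ
  sizeˡ A = ∣ take m A ∣
  sizeʳ A = ∣ drop m A ∣

  threshold : Subset (m ℕ.+ n) → Fin (m ℕ.+ n) → ℕ
  threshold A i = [ const (dˡ (sizeˡ A) (sizeʳ A)) , const (dʳ (sizeˡ A) (sizeʳ A)) ]′ (splitAt m i)

  threshold-↑ˡ : ∀ A i → threshold A (i ↑ˡ n) ≡ dˡ (sizeˡ A) (sizeʳ A)
  threshold-↑ˡ A i = cong [ _ , _ ]′ (splitAt-↑ˡ m i n)

  threshold-↑ʳ : ∀ A j → threshold A (m ↑ʳ j) ≡ dʳ (sizeˡ A) (sizeʳ A)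
  threshold-↑ʳ A j = cong [ _ , _ ]′ (splitAt-↑ʳ m n j)

  Inner : ℕ → ℕ → Set
  Inner s t = s < m × t < n

  inner? : ∀ s t → Dec (Inner s t)
  inner? s t = (s <? m) ×-dec (t <? n)

  dˡ-inner : ∀ {s t} → Inner s t → dˡ s t ≡ n ∸ t
  dˡ-inner {s} {t} h = cong (if_then n ∸ t else 1) (dec-true (inner? s t) h)

  dʳ-inner : ∀ {s t} → Inner s t → dʳ s t ≡ m ∸ s
  dʳ-inner {s} {t} h = cong (if_then m ∸ s else 1) (dec-true (inner? s t) h)

  dˡ-outer : ∀ {s t} → ¬ Inner s t → dˡ s t ≡ 1
  dˡ-outer {s} {t} h = cong (if_then n ∸ t else 1) (dec-false (inner? s t) h)

  dʳ-outer : ∀ {s t} → ¬ Inner s t → dʳ s t ≡ 1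
  dʳ-outer {s} {t} h = cong (if_then m ∸ s else 1) (dec-false (inner? s t) h)

  -- An outer pair stays outer when the sizes grow. Passing from inner to outer drops the values to
  -- 1, and inner values n ∸ t and m ∸ s are at least 1 by the strict inequalities.
  d-antitone : ∀ {s t s′ t′} → s ≤ s′ → t ≤ t′ → dˡ s′ t′ ≤ dˡ s t × dʳ s′ t′ ≤ dʳ s t
  d-antitone {s} {t} {s′} {t′} s≤ t≤ = go (inner? s t) (inner? s′ t′)
    where
    go : Dec (Inner s t) → Dec (Inner s′ t′) → dˡ s′ t′ ≤ dˡ s t × dʳ s′ t′ ≤ dʳ s t
    go (no ¬p) (yes (p , q)) = ⊥-elim (¬p (ℕ.≤-<-trans s≤ p , ℕ.≤-<-trans t≤ q))
    go (no ¬p) (no ¬q) = ℕ.≤-reflexive (trans (dˡ-outer ¬q) (sym (dˡ-outer ¬p))) , ℕ.≤-reflexive (trans (dʳ-outer ¬q) (sym (dʳ-outer ¬p)))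
    go (yes p) (yes q) = subst₂ _≤_ (sym (dˡ-inner q)) (sym (dˡ-inner p)) (ℕ.∸-monoʳ-≤ n t≤) ,
                         subst₂ _≤_ (sym (dʳ-inner q)) (sym (dʳ-inner p)) (ℕ.∸-monoʳ-≤ m s≤)
    go (yes p) (no ¬q) = subst₂ _≤_ (sym (dˡ-outer ¬q)) (sym (dˡ-inner p)) (ℕ.m<n⇒0<n∸m (proj₂ p)) ,
                         subst₂ _≤_ (sym (dʳ-outer ¬q)) (sym (dʳ-inner p)) (ℕ.m<n⇒0<n∸m (proj₁ p))

  threshold-antitone : ∀ {A B i} → A ⊆ B → i ∈ A → threshold B i ≤ threshold A i
  threshold-antitone {A} {B} {i} A⊆B _ = ↑-case m (λ i → threshold B i ≤ threshold A i)
    (λ i → subst₂ _≤_ (sym (threshold-↑ˡ B i)) (sym (threshold-↑ˡ A i)) (proj₁ le))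
    (λ j → subst₂ _≤_ (sym (threshold-↑ʳ B j)) (sym (threshold-↑ʳ A j)) (proj₂ le)) i
    where
    le : dˡ (sizeˡ B) (sizeʳ B) ≤ dˡ (sizeˡ A) (sizeʳ A) × dʳ (sizeˡ B) (sizeʳ B) ≤ dʳ (sizeˡ A) (sizeʳ A)
    le = d-antitone (p⊆q⇒∣p∣≤∣q∣ (∈-take⁺ m ∘ A⊆B ∘ ∈-take⁻ m)) (p⊆q⇒∣p∣≤∣q∣ (∈-drop⁺ m ∘ A⊆B ∘ ∈-drop⁻ m))

  d≤b : ∀ s t → dˡ s t ≤ b × dʳ s t ≤ b
  d≤b s t with does (inner? s t)
  ... | true  = ℕ.≤-trans (ℕ.m∸n≤m n t) (ℕ.m≤n⇒m≤1+n (ℕ.m≤n+m n m)) , ℕ.≤-trans (ℕ.m∸n≤m m s) (ℕ.m≤n⇒m≤1+n (ℕ.m≤m+n m n))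
  ... | false = s≤s z≤n , s≤s z≤n

  threshold≤b : ∀ A i → threshold A i ≤ b
  threshold≤b A = ↑-case m (λ i → threshold A i ≤ b)
    (λ i → subst (_≤ b) (sym (threshold-↑ˡ A i)) (proj₁ (d≤b (sizeˡ A) (sizeʳ A))))
    (λ j → subst (_≤ b) (sym (threshold-↑ʳ A j)) (proj₂ (d≤b (sizeˡ A) (sizeʳ A))))

  size-⊤ : sizeˡ ⊤ ≡ m × sizeʳ ⊤ ≡ n
  size-⊤ = trans (cong ∣_∣ (take-replicate m n inside)) (∣⊤∣≡n m) , trans (cong ∣_∣ (drop-replicate m n inside)) (∣⊤∣≡n n)

  size-full : ∀ A → sizeˡ A ≡ m → sizeʳ A ≡ n → A ≡ ⊤
  size-full A eq eq′ = ∣p∣≡n⇒p≡⊤ (trans (sym (∣take∣+∣drop∣ m A)) (cong₂ ℕ._+_ eq eq′))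

  open Stability threshold

  private
    -d : Subset (m ℕ.+ n) → Fin (m ℕ.+ n) → ℤ
    -d A i = - (+ threshold A i)

    F : Subset (m ℕ.+ n) → ℤ
    F A = potential (sizeˡ A) (sizeʳ A)

    links-sizes : ∀ A (S : Subset m) (T : Subset n) → links A (S ++ T) (-d (S ++ T)) * F (S ++ T) ≡
      links (take m A) S (λ _ → - (+ dˡ (∣ S ∣) (∣ T ∣))) * links (drop m A) T (λ _ → - (+ dʳ (∣ S ∣) (∣ T ∣))) * potential (∣ S ∣) (∣ T ∣)
    links-sizes A S T = begin
      links A (S ++ T) (-d (S ++ T)) * F (S ++ T)
        ≡⟨ cong (_* F (S ++ T)) (links-++ m A (S ++ T) (-d (S ++ T))) ⟩
      links (take m A) (take m (S ++ T)) (λ i → -d (S ++ T) (i ↑ˡ n)) * links (drop m A) (drop m (S ++ T)) (λ j → -d (S ++ T) (m ↑ʳ j)) * F (S ++ T)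
        ≡⟨ cong₂ (λ p q → p * q * F (S ++ T))
             (links-cong (take m A) (take m (S ++ T)) λ i → cong (λ z → - (+ z)) (threshold-↑ˡ (S ++ T) i))
             (links-cong (drop m A) (drop m (S ++ T)) λ j → cong (λ z → - (+ z)) (threshold-↑ʳ (S ++ T) j)) ⟩
      G (take m (S ++ T)) (drop m (S ++ T))
        ≡⟨ cong₂ G (take-++ S T) (drop-++ S T) ⟩
      G S T ∎
      where
      open ≡-Reasoning
      G : Subset m → Subset n → ℤ
      G S T = links (take m A) S (λ _ → - (+ dˡ (∣ S ∣) (∣ T ∣))) * links (drop m A) T (λ _ → - (+ dʳ (∣ S ∣) (∣ T ∣))) * potential (∣ S ∣) (∣ T ∣)

    -- Thresholds and the candidate F see a subset only through its two sizes, so the system indexed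
    -- by subsets collapses to the one solved by `∑∑-transfer-potential`.
    F-eq : ∀ A → ∑ (subsets (m ℕ.+ n)) (λ A′ → links A A′ (-d A′) * F A′) ≡ 𝟙 (A ≟ˢ ⊤)
    F-eq A = begin
      ∑ (subsets (m ℕ.+ n)) (λ A′ → links A A′ (-d A′) * F A′)
        ≡⟨ ∑-subsets-++ m _ ⟩
      ∑ (subsets m) (λ S → ∑ (subsets n) (λ T → links A (S ++ T) (-d (S ++ T)) * F (S ++ T)))
        ≡⟨ ∑-cong (subsets m) (λ S → ∑-cong (subsets n) λ T → links-sizes A S T) ⟩
      _ ≡⟨ ∑-links-group₂ (take m A) (drop m A) (λ s t → - (+ dˡ s t)) (λ s t → - (+ dʳ s t)) potential
             (s≤s (ℕ.m≤m+n m n)) (s≤s (ℕ.m≤n+m n m)) ⟩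
      ∑∑ (λ s t → transfer (sizeˡ A) (sizeʳ A) s t * potential s t)
        ≡⟨ ∑∑-transfer-potential (s≤s (ℕ.≤-trans (∣p∣≤n (take m A)) (ℕ.m≤m+n m n)))
             (s≤s (ℕ.≤-trans (∣p∣≤n (drop m A)) (ℕ.m≤n+m n m))) ⟩
      end (sizeˡ A) (sizeʳ A)
        ≡⟨ 𝟙-cong ((sizeˡ A ≟ m) ×-dec (sizeʳ A ≟ n)) (A ≟ˢ ⊤) (λ (p , q) → size-full A p q) (λ { refl → size-⊤ }) ⟩
      𝟙 (A ≟ˢ ⊤) ∎
      where open ≡-Reasoning

  count-stable : m ≥ 1 → + List.length (filter (stable? ⊤) (box b ⊤)) ≡ signedSum m n
  count-stable m≥1 = begin
    + List.length (filter (stable? ⊤) (box b ⊤))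
      ≡⟨ ∑-length (filter (stable? ⊤) (box b ⊤)) ⟨
    ∑ (filter (stable? ⊤) (box b ⊤)) (λ _ → 1ℤ)
      ≡⟨ ∑-filter (stable? ⊤) (box b ⊤) _ ⟩
    ∑ (box b ⊤) (λ P → 𝟙 (stable? ⊤ P) * 1ℤ)
      ≡⟨ ∑-cong (box b ⊤) (λ P → ℤ.*-identityʳ (𝟙 (stable? ⊤ P))) ⟩
    stableCount threshold-antitone b threshold≤b ⊤
      ≡⟨ stableCount-⊤ threshold-antitone b threshold≤b F F-eq ⟩
    potential (sizeˡ ⊥) (sizeʳ ⊥)
      ≡⟨ cong₂ potential (trans (cong ∣_∣ (take-replicate m n outside)) (∣⊥∣≡0 m))
           (trans (cong ∣_∣ (drop-replicate m n outside)) (∣⊥∣≡0 n)) ⟩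
    potential 0 0
      ≡⟨ signedSum-potential m≥1 ⟨
    signedSum m n ∎
    where open ≡-Reasoning

  open RootedGraph (completeBipartite m n)

  private
    firstˡ : ∀ i → (suc (toℕ (i ↑ˡ n)) ≤ᵇ m) ≡ true
    firstˡ i = dec-true (suc (toℕ (i ↑ˡ n)) ≤? m) (subst (_< m) (sym (toℕ-↑ˡ i n)) (toℕ<n i))

    firstʳ : ∀ (j : Fin n) → (suc (toℕ (m ↑ʳ j)) ≤ᵇ m) ≡ false
    firstʳ j = dec-false (suc (toℕ (m ↑ʳ j)) ≤? m) (ℕ.≤⇒≯ (subst (m ≤_) (sym (toℕ-↑ʳ m j)) (ℕ.m≤m+n m (toℕ j))))

    edge : Bool → Bool → ℕ
    edge p q = if p xor q then 1 else 0

  degreeOf : Subset (m ℕ.+ n) → Fin (m ℕ.+ n) → ℕ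
  degreeOf A i = subsetSum (∁ (outside ∷ A)) (edges (suc i))

  -- The first summand is the root, which belongs to the first part and lies outside every A; the
  -- other two count the non-root vertices of each part outside A.
  degreeOf-split : ∀ A i {p} → (suc (toℕ i) ≤ᵇ m) ≡ p →
    degreeOf A i ≡ edge p true ℕ.+ ((m ∸ sizeˡ A) ℕ.* edge p true ℕ.+ (n ∸ sizeʳ A) ℕ.* edge p false)
  degreeOf-split A i refl = trans (subsetSum-∷ inside (∁ A) (edges (suc i))) (cong (edge (suc (toℕ i) ≤ᵇ m) true ℕ.+_)
    (trans (subsetSum-split m (∁ A) (λ j → edges (suc i) (suc j))
        (λ j → cong (edge (suc (toℕ i) ≤ᵇ m)) (firstˡ j)) (λ j → cong (edge (suc (toℕ i) ≤ᵇ m)) (firstʳ j)))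
      (cong₂ (λ s t → s ℕ.* edge (suc (toℕ i) ≤ᵇ m) true ℕ.+ t ℕ.* edge (suc (toℕ i) ≤ᵇ m) false)
        (trans (cong ∣_∣ (take-map _ m A)) (∣∁p∣≡n∸∣p∣ (take m A)))
        (trans (cong ∣_∣ (drop-map _ m A)) (∣∁p∣≡n∸∣p∣ (drop m A))))))

  degreeOf-↑ˡ : ∀ A i → degreeOf A (i ↑ˡ n) ≡ n ∸ sizeʳ A
  degreeOf-↑ˡ A i = trans (degreeOf-split A (i ↑ˡ n) (firstˡ i))
    (cong₂ ℕ._+_ (ℕ.*-zeroʳ (m ∸ sizeˡ A)) (ℕ.*-identityʳ (n ∸ sizeʳ A)))

  degreeOf-↑ʳ : ∀ A j → degreeOf A (m ↑ʳ j) ≡ suc (m ∸ sizeˡ A)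
  degreeOf-↑ʳ A j = trans (degreeOf-split A (m ↑ʳ j) (firstʳ j))
    (cong suc (trans (cong₂ ℕ._+_ (ℕ.*-identityʳ (m ∸ sizeˡ A)) (ℕ.*-zeroʳ (n ∸ sizeʳ A))) (ℕ.+-identityʳ _)))

-- Monomial ideals

lookup-injective : ∀ {a} {A : Set a} {xs : List A} → Unique xs → ∀ {i j} → List.lookup xs i ≡ List.lookup xs j → i ≡ j
lookup-injective {xs = x ∷ xs} _                 {zero}  {zero}  _  = refl
lookup-injective {xs = x ∷ xs} (x∉ AllPairs.∷ _) {zero}  {suc j} eq = ⊥-elim (All.lookup x∉ (∈-lookup j) eq)
lookup-injective {xs = x ∷ xs} (x∉ AllPairs.∷ _) {suc i} {zero}  eq = ⊥-elim (All.lookup x∉ (∈-lookup i) (sym eq))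
lookup-injective {xs = x ∷ xs} (_ AllPairs.∷ u)  {suc i} {suc j} eq = cong suc (lookup-injective u eq)

hasCardinality : ∀ {a p} {A : Set a} {P : Pred A p} (xs : List A) → Unique xs →
  (∀ {x} → x ∈ₗ xs → P x) → (∀ {x} → P x → x ∈ₗ xs) → HasCardinality P (List.length xs)
hasCardinality xs unique sound complete = record
  { to        = λ i → List.lookup xs i , sound (∈-lookup i)
  ; cong      = cong (List.lookup xs)
  ; bijective = lookup-injective unique , λ (x , px) →
      Any.index (complete px) , λ { refl → sym (lookup-index (complete px)) }
  }

+-∸-zipWith : ∀ {N} (P e : Vec ℕ N) → (∀ i → lookup e i ≤ lookup P i) → zipWith ℕ._+_ (zipWith _∸_ P e) e ≡ P
+-∸-zipWith []      []      h = refl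
+-∸-zipWith (p ∷ P) (x ∷ e) h = cong₂ _∷_ (ℕ.m∸n+n≡m (h zero)) (+-∸-zipWith P e (h ∘ suc))

module _ {c ℓ₁ ℓ₂} (K : HeytingField c ℓ₁ ℓ₂) (N : ℕ) where

  private module K = HeytingField K
  open Polynomial K N

  -- If 1 were 0, all elements would be equal, the difference of 0 with itself would be invertible,
  -- and 0 would be apart from itself.
  1≉0 : ¬ K.1# K.≈ K.0#
  1≉0 1≈0 = K.#-irrefl K.refl (K.invertible⇒# {K.0#} {K.0#} (K.0# , collapse _ _ , collapse _ _))
    where
    collapse : ∀ x y → x K.≈ y
    collapse x y = K.trans (zeroed x) (K.sym (zeroed y))
      where
      zeroed : ∀ x → x K.≈ K.0#
      zeroed x = K.trans (K.sym (K.*-identityˡ x)) (K.trans (K.*-congʳ 1≈0) (K.zeroˡ x))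

  monomial-ideal⁺ : ∀ {s} {S : Pred Poly s} {d e P : Exponent} → S (monomial e) → zipWith ℕ._+_ d e ≡ P → ⟨ S ⟩ (monomial P)
  monomial-ideal⁺ {S = S} {d} {e} {P} Se refl = (monomial d , monomial e , Se) ∷ [] , coefficients
    where
    coefficients : monomial P ≈ₚ combination S ((monomial d , monomial e , Se) ∷ [])
    coefficients f with ≡-dec _≟_ P f
    ... | yes _ = K.+-congʳ (K.sym (K.*-identityˡ K.1#))
    ... | no _  = K.refl

  private
    HasExponent : Exponent → K.Carrier × Exponent → Set
    HasExponent P t = proj₂ t ≡ P

    -- The argument concerns the formal list of terms, before any cancellation of coefficients: each
    -- listed exponent is a sum of an exponent from q and one from g.
    combination-term : ∀ {s} (S : Pred Poly s) L {P} → Any (HasExponent P) (combination S L) →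
      ∃ λ g → S g × ∃₂ λ t d → t ∈ₗ g × zipWith ℕ._+_ d (proj₂ t) ≡ P
    combination-term S ((q , g , Sg) ∷ L) any with findₗ any
    ... | t , t∈ , refl with ∈-++⁻ (q *ₚ g) t∈
    ...   | inj₂ t∈L = combination-term S L (lose t∈L refl)
    ...   | inj₁ t∈qg with ∈-cartesianProductWith⁻ _ q g t∈qg
    ...     | (_ , d) , u , _ , u∈g , refl = g , Sg , u , d , u∈g , refl

  -- Otherwise the coefficient of x^P in the combination would be 0, but it is 1.
  monomial-ideal⁻ : ∀ {s} {S : Pred Poly s} {P : Exponent} → ⟨ S ⟩ (monomial P) →
    ∃ λ g → S g × ∃₂ λ t d → t ∈ₗ g × zipWith ℕ._+_ d (proj₂ t) ≡ P
  monomial-ideal⁻ {S = S} {P} (L , eq) with Any.any? (λ t → ≡-dec _≟_ (proj₂ t) P) (combination S L)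
  ... | yes any = combination-term S L any
  ... | no ¬any = ⊥-elim (1≉0 (K.trans (K.sym (K.+-identityʳ K.1#)) (K.trans one (K.trans (eq P) zero′))))
    where
    one : K.1# K.+ K.0# K.≈ coeff (monomial P) P
    one with ≡-dec _≟_ P P
    ... | yes _ = K.refl
    ... | no ≢  = ⊥-elim (≢ refl)
    zero′ : coeff (combination S L) P K.≈ K.0#
    zero′ = K.reflexive (cong (List.foldr K._+_ K.0# ∘ List.map proj₁)
      (filter-none (λ t → ≡-dec _≟_ (proj₂ t) P) (¬Any⇒All¬ (combination S L) ¬any)))

-- Spherical parking functions

module Spherical {c ℓ₁ ℓ₂} (K : HeytingField c ℓ₁ ℓ₂) (m′ n′ : ℕ) where

  m n N : ℕ
  m = suc m′
  n = suc n′
  N = m ℕ.+ n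

  open Walks m n using (b)
  open Bipartite m n
  open Stability threshold
  open ParkingFunctions K (completeBipartite m n) using (idealM; skeletonIdealM)
  open Polynomial K N using (monomial)

  entry : Subset N → Fin N → ℕ
  entry A i = if lookup A i then degreeOf A i else 0

  exponent : Subset N → Vec ℕ N
  exponent A = tabulate (entry A)

  Divides : Subset N → Vec ℕ N → Set
  Divides A P = ∀ i → i ∈ A → degreeOf A i ≤ lookup P i

  exponent-∈ : ∀ {A i} → i ∈ A → lookup (exponent A) i ≡ degreeOf A i
  exponent-∈ {A} {i} i∈ = trans (lookup∘tabulate (entry A) i) (cong (if_then degreeOf A i else 0) ([]=⇒lookup i∈))

  divides⇒quotient : ∀ {A P} → Divides A P → zipWith ℕ._+_ (zipWith _∸_ P (exponent A)) (exponent A) ≡ P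
  divides⇒quotient {A} {P} div = +-∸-zipWith P (exponent A) λ i → subst (_≤ lookup P i) (sym (lookup∘tabulate (entry A) i)) (le i)
    where
    le : ∀ i → entry A i ≤ lookup P i
    le i with lookup A i in eq
    ... | true  = div i (lookup⇒[]= i A eq)
    ... | false = z≤n

  quotient⇒divides : ∀ {A P d} → zipWith ℕ._+_ d (exponent A) ≡ P → Divides A P
  quotient⇒divides {A} {P} {d} refl i i∈ = subst₂ _≤_ (exponent-∈ i∈) (sym (lookup-zipWith ℕ._+_ i d (exponent A))) (ℕ.m≤n+m _ _)

  idealM⁺ : ∀ {A P} → Nonempty A → Divides A P → idealM (monomial P)
  idealM⁺ {A} {P} ne div = monomial-ideal⁺ K N {d = zipWith _∸_ P (exponent A)} {exponent A} {P} (A , ne , refl) (divides⇒quotient {A} {P} div)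

  idealM⁻ : ∀ {P} → idealM (monomial P) → ∃[ A ] (Nonempty A × Divides A P)
  idealM⁻ {P} f with monomial-ideal⁻ K N {P = P} f
  ... | _ , (A , ne , refl) , _ , d , here refl , eq = A , ne , quotient⇒divides {A} {P} {d} eq

  skeletonIdealM⁺ : ∀ {k A P} → Nonempty A → ∣ A ∣ ≤ suc k → Divides A P → skeletonIdealM k (monomial P)
  skeletonIdealM⁺ {A = A} {P} ne le div = monomial-ideal⁺ K N {d = zipWith _∸_ P (exponent A)} {exponent A} {P} (A , ne , le , refl) (divides⇒quotient {A} {P} div)

  skeletonIdealM⁻ : ∀ {k P} → skeletonIdealM k (monomial P) → ∃[ A ] (Nonempty A × ∣ A ∣ ≤ suc k × Divides A P)
  skeletonIdealM⁻ {P = P} f with monomial-ideal⁻ K N {P = P} f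
  ... | _ , (A , ne , le , refl) , _ , d , here refl , eq = A , ne , le , quotient⇒divides {A} {P} {d} eq

  -- Numbers of edges to the root, which lies in the first part. By `degreeOf-⊤` these are also the
  -- exponents of the generator of the full set.
  root : Vec ℕ N
  root = replicate m 0 ++ replicate n 1

  root-↑ˡ : ∀ i → lookup root (i ↑ˡ n) ≡ 0
  root-↑ˡ i = trans (lookup-++ˡ (replicate m 0) (replicate n 1) i) (lookup-replicate i 0)

  root-↑ʳ : ∀ j → lookup root (m ↑ʳ j) ≡ 1
  root-↑ʳ j = trans (lookup-++ʳ (replicate m 0) (replicate n 1) j) (lookup-replicate j 1)

  shift : Vec ℕ N → Vec ℕ N
  shift P = zipWith ℕ._+_ P root

  lookup-shift : ∀ P i → lookup (shift P) i ≡ lookup P i ℕ.+ lookup root i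
  lookup-shift P i = lookup-zipWith ℕ._+_ i P root

  degreeOf-inner : ∀ {A} → Inner (sizeˡ A) (sizeʳ A) → ∀ i → degreeOf A i ≡ threshold A i ℕ.+ lookup root i
  degreeOf-inner {A} inn = ↑-case m (λ i → degreeOf A i ≡ threshold A i ℕ.+ lookup root i)
    (λ i → trans (degreeOf-↑ˡ A i) (sym (trans
      (cong₂ ℕ._+_ (trans (threshold-↑ˡ A i) (dˡ-inner {sizeˡ A} {sizeʳ A} inn)) (root-↑ˡ i)) (ℕ.+-identityʳ _))))
    (λ j → trans (degreeOf-↑ʳ A j) (sym (trans
      (cong₂ ℕ._+_ (trans (threshold-↑ʳ A j) (dʳ-inner {sizeˡ A} {sizeʳ A} inn)) (root-↑ʳ j)) (ℕ.+-comm _ 1))))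

  degreeOf-⊤ : ∀ i → degreeOf ⊤ i ≡ lookup root i
  degreeOf-⊤ = ↑-case m (λ i → degreeOf ⊤ i ≡ lookup root i)
    (λ i → trans (degreeOf-↑ˡ ⊤ i) (trans (cong (n ∸_) (proj₂ size-⊤)) (trans (ℕ.n∸n≡0 n) (sym (root-↑ˡ i)))))
    (λ j → trans (degreeOf-↑ʳ ⊤ j) (trans (cong (λ s → suc (m ∸ s)) (proj₁ size-⊤)) (trans (cong suc (ℕ.n∸n≡0 m)) (sym (root-↑ʳ j)))))

  module _ (S : Subset m) (T : Subset n) where

    size-++ˡ : sizeˡ (S ++ T) ≡ ∣ S ∣
    size-++ˡ = cong ∣_∣ (take-++ S T)

    size-++ʳ : sizeʳ (S ++ T) ≡ ∣ T ∣
    size-++ʳ = cong ∣_∣ (drop-++ S T)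

    ∈-++⁻ˡ : ∀ {i} → i ↑ˡ n ∈ S ++ T → i ∈ S
    ∈-++⁻ˡ {i} i∈ = subst (i ∈_) (take-++ S T) (∈-take⁺ m i∈)

    ∈-++⁻ʳ : ∀ {j} → m ↑ʳ j ∈ S ++ T → j ∈ T
    ∈-++⁻ʳ {j} j∈ = subst (j ∈_) (drop-++ S T) (∈-drop⁺ m j∈)

  fullˡ : ∀ {A} → ¬ sizeˡ A < m → ∀ i → i ↑ˡ n ∈ A
  fullˡ {A} ≮ i = ∈-take⁻ m (subst (i ∈_) (sym (∣p∣≡n⇒p≡⊤ {p = take m A} (ℕ.≤-antisym (∣p∣≤n (take m A)) (ℕ.≮⇒≥ ≮)))) ∈⊤)

  fullʳ : ∀ {A} → ¬ sizeʳ A < n → ∀ j → m ↑ʳ j ∈ A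
  fullʳ {A} ≮ j = ∈-drop⁻ m (subst (j ∈_) (sym (∣p∣≡n⇒p≡⊤ {p = drop m A} (ℕ.≤-antisym (∣p∣≤n (drop m A)) (ℕ.≮⇒≥ ≮)))) ∈⊤)

  -- Both sides are N - 1: the skeleton ideal of index N ∸ 2 is generated by the proper subsets.
  bound : suc (N ∸ 2) ≡ m′ ℕ.+ n
  bound = trans (cong (λ k → suc (k ∸ 1)) (ℕ.+-suc m′ n′)) (sym (ℕ.+-suc m′ n′))

  not-both-full : ∀ {A} → ∣ A ∣ ≤ suc (N ∸ 2) → ¬ (¬ sizeˡ A < m × ¬ sizeʳ A < n)
  not-both-full {A} le (p , q) = ℕ.<-irrefl refl (ℕ.≤-trans
    (ℕ.+-mono-≤ (ℕ.≮⇒≥ p) (ℕ.≮⇒≥ q)) (ℕ.≤-trans (ℕ.≤-reflexive (∣take∣+∣drop∣ m A)) (ℕ.≤-trans le (ℕ.≤-reflexive bound))))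

  -- For the modified thresholds these two sets stand for the products of the variables of either
  -- part.
  partˡ partʳ : Subset N
  partˡ = ⊤ {m} ++ ⊥ {n}
  partʳ = ⊥ {m} ++ ⊤ {n}

  threshold-partˡ : ∀ i → threshold partˡ (i ↑ˡ n) ≡ 1
  threshold-partˡ i = trans (threshold-↑ˡ partˡ i)
    (dˡ-outer {sizeˡ partˡ} {sizeʳ partˡ} λ (p , _) → ℕ.<-irrefl (trans (size-++ˡ (⊤ {m}) (⊥ {n})) (∣⊤∣≡n m)) p)

  threshold-partʳ : ∀ j → threshold partʳ (m ↑ʳ j) ≡ 1
  threshold-partʳ j = trans (threshold-↑ʳ partʳ j)
    (dʳ-outer {sizeˡ partʳ} {sizeʳ partʳ} λ (_ , q) → ℕ.<-irrefl (trans (size-++ʳ (⊥ {m}) (⊤ {n})) (∣⊤∣≡n n)) q)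

  stable⇒sPF : ∀ {P} → Stable ⊤ P → sPF K (completeBipartite m n) (shift P)
  stable⇒sPF {P} st = idealM⁺ {⊤} {shift P} (zero , here) ⊤-divides , λ sk → let A , ne , le , div = skeletonIdealM⁻ {P = shift P} sk in absurd A ne le div
    where
    ⊤-divides : Divides ⊤ (shift P)
    ⊤-divides i _ = subst₂ _≤_ (sym (degreeOf-⊤ i)) (sym (lookup-shift P i)) (ℕ.m≤n+m _ (lookup P i))

    absurd : ∀ A → Nonempty A → ∣ A ∣ ≤ suc (N ∸ 2) → ¬ Divides A (shift P)
    absurd A ne le div with sizeˡ A <? m | sizeʳ A <? n
    ... | yes p | yes q = st (A , ne , (λ _ → ∈⊤) , λ i i∈ → ℕ.+-cancelʳ-≤ (lookup root i) _ _
          (subst₂ _≤_ (degreeOf-inner {A} (p , q) i) (lookup-shift P i) (div i i∈)))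
    ... | no p | no q = not-both-full {A} le (p , q)
    -- A contains the first part and misses a vertex of the second, so its degrees on the first part
    -- are at least 1. Hence P is at least 1 there and `partˡ` is unstable.
    ... | no s≮m | yes t<n = st (partˡ , (zero , here) , (λ _ → ∈⊤) , ↑-case m (λ i → i ∈ partˡ → threshold partˡ i ≤ lookup P i)
          (λ i _ → subst₂ _≤_ (sym (threshold-partˡ i))
            (trans (lookup-shift P (i ↑ˡ n)) (trans (cong (lookup P (i ↑ˡ n) ℕ.+_) (root-↑ˡ i)) (ℕ.+-identityʳ _)))
            (ℕ.≤-trans (ℕ.m<n⇒0<n∸m t<n)
              (subst (_≤ lookup (shift P) (i ↑ˡ n)) (degreeOf-↑ˡ A i) (div (i ↑ˡ n) (fullˡ {A} s≮m i)))))
          (λ j j∈ → ⊥-elim (∉⊥ (∈-++⁻ʳ (⊤ {m}) (⊥ {n}) j∈))))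
    -- On the second part the degrees of A are at least 2, and the edge to the root accounts for one
    -- of them; P is still at least 1 there.
    ... | yes s<m | no t≮n = st (partʳ , (m ↑ʳ zero , ∈-drop⁻ m (subst (zero ∈_) (sym (drop-++ (⊥ {m}) (⊤ {n}))) here)) , (λ _ → ∈⊤) ,
        ↑-case m (λ i → i ∈ partʳ → threshold partʳ i ≤ lookup P i)
          (λ i i∈ → ⊥-elim (∉⊥ (∈-++⁻ˡ (⊥ {m}) (⊤ {n}) i∈)))
          (λ j _ → subst (_≤ lookup P (m ↑ʳ j)) (sym (threshold-partʳ j))
            (ℕ.≤-trans (ℕ.m<n⇒0<n∸m s<m) (ℕ.s≤s⁻¹ (subst₂ _≤_ (degreeOf-↑ʳ A j)
              (trans (lookup-shift P (m ↑ʳ j)) (trans (cong (lookup P (m ↑ʳ j) ℕ.+_) (root-↑ʳ j)) (ℕ.+-comm _ 1)))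
              (div (m ↑ʳ j) (fullʳ {A} t≮n j)))))))

  sPF⇒stable : ∀ {P} → sPF K (completeBipartite m n) P → ∃[ Q ] (shift Q ≡ P × Stable ⊤ Q)
  sPF⇒stable {P} (∈M , ∉skeleton) = Q , Q-shift , λ (B , ne , _ , h) → absurd B ne h
    where
    no-proper : ∀ A → Nonempty A → ∣ A ∣ ≤ suc (N ∸ 2) → ¬ Divides A P
    no-proper A ne le div = ∉skeleton (skeletonIdealM⁺ {A = A} {P} ne le div)

    -- Generators of proper subsets are excluded, so the generator dividing x^P is that of the full
    -- set, whose exponents are `root`.
    root≤P : ∀ i → lookup root i ≤ lookup P i
    root≤P i with idealM⁻ {P} ∈M
    ... | A , ne , div with ∣ A ∣ ≤? suc (N ∸ 2)
    ...   | yes le = ⊥-elim (no-proper A ne le div)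
    ...   | no ≰ with ∣p∣≡n⇒p≡⊤ {p = A} (ℕ.≤-antisym (∣p∣≤n A) (subst (_< ∣ A ∣) bound (ℕ.≰⇒> ≰)))
    ...     | refl = subst (_≤ lookup P i) (degreeOf-⊤ i) (div i ∈⊤)

    Q : Vec ℕ N
    Q = zipWith _∸_ P root

    Q-shift : shift Q ≡ P
    Q-shift = +-∸-zipWith P root root≤P

    lookup-P : ∀ i → lookup P i ≡ lookup Q i ℕ.+ lookup root i
    lookup-P i = trans (cong (λ R → lookup R i) (sym Q-shift)) (lookup-shift Q i)

    size≤ : ∀ A → sizeˡ A ℕ.+ sizeʳ A ≤ m′ ℕ.+ n → ∣ A ∣ ≤ suc (N ∸ 2)
    size≤ A le = subst₂ _≤_ (∣take∣+∣drop∣ m A) (sym bound) le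

    absurd : ∀ B → Nonempty B → ¬ (∀ i → i ∈ B → threshold B i ≤ lookup Q i)
    absurd B ne h with sizeˡ B <? m | sizeʳ B <? n
    ... | yes p | yes q = no-proper B ne (size≤ B (ℕ.+-mono-≤ (ℕ.s≤s⁻¹ p) (ℕ.<⇒≤ q))) λ i i∈ →
          subst₂ _≤_ (sym (degreeOf-inner {B} (p , q) i)) (sym (lookup-P i)) (ℕ.+-monoˡ-≤ (lookup root i) (h i i∈))
    -- B contains the first part, so Q is at least 1 on it. Dropping one vertex of the second part
    -- from the full set gives the proper set A₀ with degree 1 at all its vertices: on the first
    -- part this is covered by Q, on the second by the edge to the root.
    ... | no s≮m | _ = no-proper A₀ (zero , here)
          (size≤ A₀ (subst₂ (λ s t → s ℕ.+ t ≤ m′ ℕ.+ n) (sym sA) (sym tA) (ℕ.≤-reflexive (sym (ℕ.+-suc m′ n′)))))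
          (↑-case m (λ i → i ∈ A₀ → degreeOf A₀ i ≤ lookup P i)
            (λ i _ → subst₂ _≤_ (sym (trans (degreeOf-↑ˡ A₀ i) (trans (cong (n ∸_) tA) (ℕ.m+n∸n≡m 1 n′)))) (sym (lookup-P (i ↑ˡ n)))
              (ℕ.≤-trans (subst (_≤ lookup Q (i ↑ˡ n)) (trans (threshold-↑ˡ B i) (dˡ-outer {sizeˡ B} {sizeʳ B} (s≮m ∘ proj₁))) (h (i ↑ˡ n) (fullˡ {B} s≮m i)))
                (ℕ.m≤m+n _ _)))
            (λ j _ → subst (_≤ lookup P (m ↑ʳ j))
              (trans (root-↑ʳ j) (sym (trans (degreeOf-↑ʳ A₀ j) (cong suc (trans (cong (m ∸_) sA) (ℕ.n∸n≡0 m))))))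
              (root≤P (m ↑ʳ j))))
          where
          A₀ : Subset N
          A₀ = ⊤ {m} ++ (outside ∷ ⊤ {n′})
          sA : sizeˡ A₀ ≡ m
          sA = trans (size-++ˡ (⊤ {m}) (outside ∷ ⊤ {n′})) (∣⊤∣≡n m)
          tA : sizeʳ A₀ ≡ n′
          tA = trans (size-++ʳ (⊤ {m}) (outside ∷ ⊤ {n′})) (∣⊤∣≡n n′)
    -- Here A₀ omits one vertex of the first part. Its degrees are 0 on the first part and 2 on the
    -- second, where Q supplies 1 and the root the other 1.
    ... | yes _ | no t≮n = no-proper A₀ (m ↑ʳ zero , ∈-drop⁻ m (subst (zero ∈_) (sym (drop-++ (outside ∷ ⊤ {m′}) (⊤ {n}))) here))
          (size≤ A₀ (subst₂ (λ s t → s ℕ.+ t ≤ m′ ℕ.+ n) (sym sA) (sym tA) ℕ.≤-refl))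
          (↑-case m (λ i → i ∈ A₀ → degreeOf A₀ i ≤ lookup P i)
            (λ i _ → subst (_≤ lookup P (i ↑ˡ n)) (sym (trans (degreeOf-↑ˡ A₀ i) (trans (cong (n ∸_) tA) (ℕ.n∸n≡0 n)))) z≤n)
            (λ j _ → subst₂ _≤_
              (sym (trans (degreeOf-↑ʳ A₀ j) (cong suc (trans (cong (m ∸_) sA) (ℕ.m+n∸n≡m 1 m′)))))
              (sym (trans (lookup-P (m ↑ʳ j)) (trans (cong (lookup Q (m ↑ʳ j) ℕ.+_) (root-↑ʳ j)) (ℕ.+-comm _ 1))))
              (s≤s (subst (_≤ lookup Q (m ↑ʳ j)) (trans (threshold-↑ʳ B j) (dʳ-outer {sizeˡ B} {sizeʳ B} (t≮n ∘ proj₂))) (h (m ↑ʳ j) (fullʳ {B} t≮n j))))))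
          where
          A₀ : Subset N
          A₀ = (outside ∷ ⊤ {m′}) ++ ⊤ {n}
          sA : sizeˡ A₀ ≡ m′
          sA = trans (size-++ˡ (outside ∷ ⊤ {m′}) (⊤ {n})) (∣⊤∣≡n m′)
          tA : sizeʳ A₀ ≡ n
          tA = trans (size-++ʳ (outside ∷ ⊤ {m′}) (⊤ {n})) (∣⊤∣≡n n)

  shift-injective : ∀ {P Q} → shift P ≡ shift Q → P ≡ Q
  shift-injective {P} {Q} = cancel P Q root
    where
    cancel : ∀ {k} (P Q r : Vec ℕ k) → zipWith ℕ._+_ P r ≡ zipWith ℕ._+_ Q r → P ≡ Q
    cancel []      []      []      _  = refl
    cancel (p ∷ P) (q ∷ Q) (x ∷ r) eq = let eq₁ , eq₂ = ∷-injective eq in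
      cong₂ _∷_ (ℕ.+-cancelʳ-≡ x p q eq₁) (cancel P Q r eq₂)

  stables : List (Vec ℕ N)
  stables = filter (stable? ⊤) (box b ⊤)

  sPF-cardinality : HasCardinality (sPF K (completeBipartite m n)) (List.length (map shift stables))
  sPF-cardinality = hasCardinality (map shift stables)
    (Uniqueₚ.map⁺ shift-injective (Uniqueₚ.filter⁺ (stable? ⊤) (box-unique b)))
    sound complete
    where
    sound : ∀ {P} → P ∈ₗ map shift stables → sPF K (completeBipartite m n) P
    sound P∈ with ∈-map⁻ shift P∈
    ... | Q , Q∈ , refl = stable⇒sPF {Q} (proj₂ (∈-filter⁻ (stable? ⊤) {xs = box b ⊤} Q∈))

    complete : ∀ {P} → sPF K (completeBipartite m n) P → P ∈ₗ map shift stables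
    complete {P} sp with sPF⇒stable {P} sp
    ... | Q , refl , st = ∈-map⁺ shift (∈-filter⁺ (stable? ⊤) (∈-box b Q (stable-bounded threshold≤b {Q} st)) st)

proposition3p4 : ∀ {c ℓ₁ ℓ₂} (K : HeytingField c ℓ₁ ℓ₂) (m n : ℕ) → m ≥ 1 → n ≥ 1 →
    ∃[ N ] (HasCardinality (sPF K (completeBipartite m n)) N × + N ≡ signedSum m n)
proposition3p4 K m@(suc m′) n@(suc n′) m≥1 n≥1 = List.length (map shift stables) , sPF-cardinality ,
  trans (cong +_ (length-map shift stables)) (count-stable m≥1)
  where
  open Spherical K m′ n′ using (shift; stables; sPF-cardinality)
  open Bipartite m n using (count-stable)
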